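{- The $n$-th moment of the $q$-Laguerre polynomials $L_n(x;q)$ is equal to $\mu_n^{(\ell)}(y,q)=\sum_{\sigma\in S_n}y^{\mathrm{wex}(\sigma)}q^{\mathrm{cr}(\sigma)}$. More precisely, let $\mathcal{L}_q$ be the linear functional on polynomials in $x$ defined by $\mathcal{L}_q(x^n)=\mu_n^{(\ell)}(y,q)$ for all $n\ge 0$. Then for all integers $n_1,n_2\ge 0$, $$\mathcal{L}_q\bigl(L_{n_1}(x;q)L_{n_2}(x;q)\bigr)=y^{n_1}(n_1!_q)^2\,\delta_{n_1\,n_2}.$$
   Context: Notation: $[n]_q=\frac{1-q^n}{1-q}$, $n!_q=\prod_{j=1}^n[j]_q$; $\delta$ is the Kronecker delta. The Al-Salam-Chihara polynomials $Q_n(x;\alpha,\beta|q)$ are defined by $Q_{ -1}=0$, $Q_0=1$, $Q_{n+1}(x)=(2x-(\alpha+\beta)q^n)Q_n(x)-(1-q^n)(1-\alpha\beta q^{n-1})Q_{n-1}(x)$. The $q$-Laguerre polynomials (depending on a parameter $y$) are $$L_n(x;q)=\left(\frac{\sqrt y}{q-1}\right)^nQ_n\left(\frac{(q-1)x+y+1}{2\sqrt y};\frac1{\sqrt y},\sqrt y\,q\,\Big|\,q\right),$$ and they satisfy $L_{ -1}(x;q)=0$, $L_0(x;q)=1$, $L_{n+1}(x;q)=(x-y[n+1]_q-[n]_q)L_n(x;q)-y[n]_q^2L_{n-1}(x;q)$. $S_n$ is the set of permutations of $[n]=\{1,\dots,n\}$. For $\sigma\in S_n$, the number of weak excedances is $\mathrm{wex}(\sigma)=\#\{i: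 1\le i\le n,\ i\le\sigma(i)\}$, and the number of crossings is $$\mathrm{cr}(\sigma)=\sum_{i=1}^n\#\{j: j<i\le\sigma(j)<\sigma(i)\}+\sum_{i=1}^n\#\{j: j>i>\sigma(j)>\sigma(i)\}.$$ In particular $\mu_0^{(\ell)}(y,q)=1$. -}

module Defs where

open import Algebra.Bundles using (CommutativeRing)
import Algebra.Definitions as AlgebraDefinitions
open import Data.Bool.Base using (if_then_else_)
open import Data.Fin.Base using (Fin; zero; punchIn; _≤_; _<_)
open import Data.Fin.Properties using (_≤?_; _<?_; punchIn-injective)
import Data.Fin.Properties as Fin
open import Data.Fin.Permutation as Perm
  using (Permutation′; insert; remove; insert-punchIn; insert-remove; _⟨$⟩ʳ_)
open import Data.List.Base
  using (List; []; _∷_; map; foldr; filter; length; allFin; cartesianProductWith)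
import Data.List.Membership.Propositional.Properties as Membership
import Data.List.Membership.Setoid.Properties as SetoidMembership
open import Data.List.Relation.Unary.All using ([])
open import Data.List.Relation.Unary.AllPairs using ([]; _∷_)
open import Data.List.Relation.Unary.Any using (here)
open import Data.List.Relation.Unary.Enumerates.Setoid using (IsEnumeration)
import Data.List.Relation.Unary.Unique.Propositional.Properties as Unique
open import Data.List.Relation.Unary.Unique.Setoid using (Unique)
import Data.List.Relation.Unary.Unique.Setoid.Properties as SetoidUnique
open import Data.Nat.Base as ℕ using (ℕ; zero; suc)
import Data.Nat.ListAction as ℕ using (sum)
import Data.Nat.Properties as ℕ using (_≟_)
open import Data.Product.Base using (_×_; _,_; proj₁)
open import Level using (0ℓ; _⊔_)
open import Relation.Binary.Bundles using (Setoid)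
open import Relation.Binary.PropositionalEquality
  using (_≡_; refl; sym; trans; cong; cong₂; setoid)
open import Relation.Nullary.Decidable using (does; yes; no; _×-dec_)
open import Relation.Nullary.Negation using (contradiction)

------------------------------------------------------------------------
-- Permutations and their statistics
--
-- [n] is Fin n, i.e. shifted to start at 0; both statistics depend only
-- on the relative order of positions and values.

permutations : ∀ n → List (Permutation′ n)
permutations zero    = Perm.id ∷ []
permutations (suc n) =
  cartesianProductWith (insert zero) (allFin (suc n)) (permutations n)

wex : ∀ {n} → Permutation′ n → ℕ
wex {n} σ = length (filter (λ i → i ≤? (σ ⟨$⟩ʳ i)) (allFin n))

cr : ∀ {n} → Permutation′ n → ℕ
cr {n} σ = ℕ.sum (map upper (allFin n)) ℕ.+ ℕ.sum (map lower (allFin n))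
  where
  upper lower : Fin n → ℕ
  upper i = length (filter
    (λ j → j <? i ×-dec (i ≤? (σ ⟨$⟩ʳ j) ×-dec (σ ⟨$⟩ʳ j) <? (σ ⟨$⟩ʳ i)))
    (allFin n))
  lower i = length (filter
    (λ j → i <? j ×-dec ((σ ⟨$⟩ʳ j) <? i ×-dec (σ ⟨$⟩ʳ i) <? (σ ⟨$⟩ʳ j)))
    (allFin n))

-- Every permutation occurs in the list exactly once.

≈-setoid : ℕ → Setoid 0ℓ 0ℓ
≈-setoid n = record
  { Carrier       = Permutation′ n
  ; _≈_           = Perm._≈_
  ; isEquivalence = record
    { refl  = λ _ → refl
    ; sym   = λ p i → sym (p i)
    ; trans = λ p r i → trans (p i) (r i)
    }
  }

insert-cong : ∀ {n} {j k : Fin (suc n)} {π ρ : Permutation′ n} →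
              j ≡ k → π Perm.≈ ρ → insert zero j π Perm.≈ insert zero k ρ
insert-cong {j = j} refl p i with zero Fin.≟ i
... | yes _ = refl
... | no  _ = cong (punchIn j) (p _)

insert-injective : ∀ {n} {j k : Fin (suc n)} {π ρ : Permutation′ n} →
                   insert zero j π Perm.≈ insert zero k ρ → j ≡ k × π Perm.≈ ρ
insert-injective {j = j} {π = π} {ρ} p with p zero
... | refl = refl , λ i → punchIn-injective j _ _
  (trans (sym (insert-punchIn zero j π i))
         (trans (p (punchIn zero i)) (insert-punchIn zero j ρ i)))

permutations-enumerates : ∀ n → IsEnumeration (≈-setoid n) (permutations n)
permutations-enumerates zero    σ = here λ ()
permutations-enumerates (suc n) σ =
  SetoidMembership.∈-resp-≈ (≈-setoid (suc n))
    {x = insert zero (σ ⟨$⟩ʳ zero) (remove zero σ)} {y = σ} (insert-remove zero σ)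
    (SetoidMembership.∈-cartesianProductWith⁺
      (setoid (Fin (suc n))) (≈-setoid n) (≈-setoid (suc n))
      (λ {_} {_} {π} {ρ} → insert-cong {π = π} {ρ})
      (Membership.∈-allFin (σ ⟨$⟩ʳ zero))
      (permutations-enumerates n (remove zero σ)))

permutations-unique : ∀ n → Unique (≈-setoid n) (permutations n)
permutations-unique zero    = [] ∷ []
permutations-unique (suc n) = SetoidUnique.cartesianProductWith⁺
  (setoid (Fin (suc n))) (≈-setoid n) (≈-setoid (suc n)) (insert zero)
  (λ {_} {_} {π} {ρ} → insert-injective {π = π} {ρ})
  (Unique.allFin⁺ (suc n)) (permutations-unique n)

------------------------------------------------------------------------
-- Univariate polynomials, as coefficient lists with the constant term
-- first. Trailing zeros are allowed, so equality is _≈ₚ_.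

module Polynomial {c ℓ} (R : CommutativeRing c ℓ) where

  open CommutativeRing R hiding (zero; refl; sym; trans; setoid)
  private module R = CommutativeRing R

  Poly : Set c
  Poly = List Carrier

  coeff : Poly → ℕ → Carrier
  coeff []      _       = 0#
  coeff (a ∷ _) zero    = a
  coeff (_ ∷ p) (suc k) = coeff p k

  infix  4 _≈ₚ_
  infixl 6 _+ₚ_ _-ₚ_
  infixl 7 _*ₚ_
  infixr 7 _·ₚ_
  infixr 8 _^ₚ_
  infix  9 _[_]

  _≈ₚ_ : Poly → Poly → Set ℓ
  p ≈ₚ r = ∀ k → coeff p k ≈ coeff r k

  const : Carrier → Poly
  const a = a ∷ []

  X : Poly
  X = 0# ∷ 1# ∷ []

  _+ₚ_ : Poly → Poly → Poly
  []      +ₚ r       = r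
  (a ∷ p) +ₚ []      = a ∷ p
  (a ∷ p) +ₚ (b ∷ r) = (a + b) ∷ (p +ₚ r)

  _·ₚ_ : Carrier → Poly → Poly
  a ·ₚ p = map (a *_) p

  _-ₚ_ : Poly → Poly → Poly
  p -ₚ r = p +ₚ (- 1#) ·ₚ r

  _*ₚ_ : Poly → Poly → Poly
  []      *ₚ r = []
  (a ∷ p) *ₚ r = a ·ₚ r +ₚ (0# ∷ p *ₚ r)

  _^ₚ_ : Poly → ℕ → Poly
  p ^ₚ zero  = const 1#
  p ^ₚ suc n = p *ₚ p ^ₚ n

  -- p [ t ] is p with t substituted for the variable.
  _[_] : Poly → Poly → Poly
  []      [ t ] = []
  (a ∷ p) [ t ] = const a +ₚ t *ₚ p [ t ]

  -- The linear functional determined by Xⁿ ↦ μ n.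
  functional : (ℕ → Carrier) → Poly → Carrier
  functional μ []      = 0#
  functional μ (a ∷ p) = a * μ 0 + functional (λ n → μ (suc n)) p

  module _ where
    open import Algebra.Properties.CommutativeSemigroup
      (CommutativeRing.+-commutativeSemigroup R) using (interchange)
    open import Relation.Binary.Reasoning.Setoid R.setoid

    functional-+ : ∀ μ p r →
                   functional μ (p +ₚ r) ≈ functional μ p + functional μ r
    functional-+ μ []      r       = R.sym (+-identityˡ _)
    functional-+ μ (a ∷ p) []      = R.sym (+-identityʳ _)
    functional-+ μ (a ∷ p) (b ∷ r) =
      R.trans (+-cong (distribʳ _ _ _) (functional-+ _ p r))
              (interchange _ _ _ _)

    functional-· : ∀ μ a p → functional μ (a ·ₚ p) ≈ a * functional μ p
    functional-· μ a []      = R.sym (zeroʳ a)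
    functional-· μ a (b ∷ p) =
      R.trans (+-cong (*-assoc _ _ _) (functional-· _ a p))
              (R.sym (distribˡ _ _ _))

    functional-0 : ∀ μ p → p ≈ₚ [] → functional μ p ≈ 0#
    functional-0 μ []      _   = R.refl
    functional-0 μ (a ∷ p) p≈0 = begin
      a * μ 0 + functional _ p
        ≈⟨ +-cong (*-congʳ (p≈0 0)) (functional-0 _ p (λ k → p≈0 (suc k))) ⟩
      0# * μ 0 + 0#  ≈⟨ +-identityʳ _ ⟩
      0# * μ 0       ≈⟨ zeroˡ _ ⟩
      0#             ∎

    functional-cong : ∀ μ p r → p ≈ₚ r → functional μ p ≈ functional μ r
    functional-cong μ []      r       p≈r =
      R.sym (functional-0 μ r (λ k → R.sym (p≈r k)))
    functional-cong μ (a ∷ p) []      p≈r = functional-0 μ (a ∷ p) p≈r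
    functional-cong μ (a ∷ p) (b ∷ r) p≈r =
      +-cong (*-congʳ (p≈r 0)) (functional-cong _ p r (λ k → p≈r (suc k)))

    functional-X* : ∀ μ p →
           functional μ (X *ₚ p) ≈ functional (λ n → μ (suc n)) p
    functional-X* μ p = begin
      functional μ (0# ·ₚ p +ₚ (0# ∷ 1# ·ₚ p +ₚ (0# ∷ [])))
        ≈⟨ functional-+ μ (0# ·ₚ p) _ ⟩
      functional μ (0# ·ₚ p) + (0# * μ 0 + functional _ (1# ·ₚ p +ₚ (0# ∷ [])))
        ≈⟨ +-cong (R.trans (functional-· μ 0# p) (zeroˡ _))
                  (+-cong (zeroˡ _) (functional-+ _ (1# ·ₚ p) _)) ⟩
      0# + (0# + (functional _ (1# ·ₚ p) + (0# * μ 1 + 0#)))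
        ≈⟨ R.trans (+-identityˡ _) (+-identityˡ _) ⟩
      functional _ (1# ·ₚ p) + (0# * μ 1 + 0#)
        ≈⟨ +-cong (R.trans (functional-· _ 1# p) (*-identityˡ _))
                  (R.trans (+-identityʳ _) (zeroˡ _)) ⟩
      functional _ p + 0#
        ≈⟨ +-identityʳ _ ⟩
      functional _ p ∎

    functional-X^ : ∀ μ n → functional μ (X ^ₚ n) ≈ μ n
    functional-X^ μ zero    = R.trans (+-identityʳ _) (*-identityˡ _)
    functional-X^ μ (suc n) =
      R.trans (functional-X* μ (X ^ₚ n)) (functional-X^ (λ k → μ (suc k)) n)

------------------------------------------------------------------------
-- The parameters q and y, in any commutative ring where the divisions by
-- 2√y and 1 - q in the definition of the q-Laguerre polynomials make
-- sense; for instance the field ℚ(√y, q) of rational functions.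

record Parameters {c ℓ} (R : CommutativeRing c ℓ) : Set (c ⊔ ℓ) where
  open CommutativeRing R
  open AlgebraDefinitions _≈_ using (Invertible)
  field
    q y √y         : Carrier
    √y*√y≈y        : √y * √y ≈ y
    2-invertible   : Invertible 1# _*_ (1# + 1#)
    √y-invertible  : Invertible 1# _*_ √y
    1-q-invertible : Invertible 1# _*_ (1# - q)

module QLaguerre {c ℓ} {R : CommutativeRing c ℓ} (P : Parameters R) where

  open CommutativeRing R hiding (zero; refl; sym; trans; setoid)
  open import Algebra.Properties.Semiring.Exp semiring using (_^_)
  open Polynomial R
  open Parameters P

  2# 2⁻¹ √y⁻¹ ⟨1-q⟩⁻¹ ⟨q-1⟩⁻¹ : Carrier
  2#      = 1# + 1#
  2⁻¹     = proj₁ 2-invertible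
  √y⁻¹    = proj₁ √y-invertible
  ⟨1-q⟩⁻¹ = proj₁ 1-q-invertible
  ⟨q-1⟩⁻¹ = - ⟨1-q⟩⁻¹

  ⟦_⟧ : ℕ → Carrier
  ⟦ n ⟧ = (1# - q ^ n) * ⟨1-q⟩⁻¹

  infix 9 _!q
  _!q : ℕ → Carrier
  zero  !q = 1#
  suc n !q = n !q * ⟦ suc n ⟧

  -- Al-Salam–Chihara polynomials. In the case of index 1 the term with
  -- Q₋₁ = 0 is dropped.
  Q : Carrier → Carrier → ℕ → Poly
  Q α β 0             = const 1#
  Q α β 1             = (2# ·ₚ X -ₚ const ((α + β) * q ^ 0)) *ₚ Q α β 0
  Q α β (suc (suc n)) =
    (2# ·ₚ X -ₚ const ((α + β) * q ^ suc n)) *ₚ Q α β (suc n)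
    -ₚ ((1# - q ^ suc n) * (1# - α * β * q ^ n)) ·ₚ Q α β n

  L : ℕ → Poly
  L n = (√y * ⟨q-1⟩⁻¹) ^ n
        ·ₚ Q √y⁻¹ (√y * q) n
             [ (2⁻¹ * √y⁻¹) ·ₚ ((q - 1#) ·ₚ X +ₚ const y +ₚ const 1#) ]

  μ : ℕ → Carrier
  μ n = foldr _+_ 0# (map (λ σ → y ^ wex σ * q ^ cr σ) (permutations n))

  𝓛 : Poly → Carrier
  𝓛 = functional μ

  δ : ℕ → ℕ → Carrier
  δ m n = if does (m ℕ.≟ n) then 1# else 0#

{-# OPTIONS --safe #-}

-- Scan a permutation from left to right, cutting each arc i ↦ σ i at the
-- current point. The ways to complete a partial scan with k open upper and k
-- open lower arcs are the permutations mapping their first k positions to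
-- values ≥ k; W k k is the sum of their weights. Deleting the arc into
-- the value k or out of the position k removes a power of q whose exponent
-- runs over an interval, so these sums obey a recurrence with q-integer
-- coefficients. It says that μ n is the entry at 0 of Jⁿ δ₀, where J is the
-- transposed Jacobi matrix of the polynomials L. Hence 𝓛 p = (p(J) δ₀)₀, and
-- orthogonality follows from (Lₙ(J) v)₀ = vₙ and Lₙ(J) δ₀ = norm n · δₙ, both
-- of which are consequences of the three-term recurrence of L.

module Submission where

open import Defs
open import Algebra.Bundles using (CommutativeMonoid; CommutativeRing)
open import Data.Bool.Base using (Bool; true; false; if_then_else_)
open import Data.Fin.Base using (Fin; zero; suc; punchIn; toℕ; fromℕ<; _≤_; _<_)
open import Data.Fin.Properties
  using ( _≤?_; _<?_; all?; toℕ<n; toℕ-fromℕ<; toℕ-injective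
        ; punchIn-mono-≤; punchIn-cancel-≤; punchIn-injective; punchInᵢ≢i)
import Data.Fin.Properties as Fin
open import Data.Fin.Permutation as Perm
  using (Permutation′; insert; remove; insert-punchIn; insert-remove; _⟨$⟩ʳ_; _⟨$⟩ˡ_)
open import Data.List.Base
  using (List; []; _∷_; _++_; map; foldr; filter; length; allFin; tabulate; cartesianProductWith)
import Data.List.Properties as List
import Data.List.Membership.Propositional.Properties as Membership
import Data.List.Membership.Setoid.Properties as SetoidMembership
import Data.List.Relation.Binary.Permutation.Setoid.Properties as Permutation
open import Data.List.Relation.Unary.All using (All)
open import Data.List.Relation.Unary.AllPairs using ([]; _∷_)
open import Data.List.Relation.Unary.Any using (here; there)
open import Data.List.Relation.Unary.Enumerates.Setoid using (IsEnumeration)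
import Data.List.Relation.Unary.Unique.Propositional.Properties as Unique
open import Data.List.Relation.Unary.Unique.Setoid using (Unique)
import Data.List.Relation.Unary.Unique.Setoid.Properties as SetoidUnique
open import Data.Nat.Base as ℕ using (ℕ; zero; suc; pred; _∸_; z≤n; s≤s)
import Data.Nat.ListAction as ℕ using (sum)
import Data.Nat.Properties as ℕ
open import Data.Product.Base using (_×_; _,_; proj₂)
open import Data.Sum.Base using (_⊎_; inj₁; inj₂)
open import Function.Base using (id; _∘_)
open import Level using (_⊔_)
open import Relation.Binary.Bundles using (Setoid)
open import Relation.Binary.PropositionalEquality as ≡ using (_≡_; module ≡-Reasoning)
open import Relation.Nullary.Decidable using (Dec; does; yes; no; _×-dec_; _→-dec_)
open import Relation.Nullary.Negation using (contradiction; ¬_)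
open import Relation.Unary using (Pred; Decidable)
import Algebra.Properties.Semiring.Exp as Exp

-- Both statistics compare positions with values, whereas deleting an arc `i ↦ v` renumbers
-- positions around `i` and values around `v`. If `i` and `v` differ, such comparisons need not
-- survive, so removing an arbitrary arc spoils `wex` and `cr`. The condition `Avoids a b` is the
-- remedy: for arcs at the scan line it guarantees that every comparison that matters is preserved.
-- One step of the scan consists of two halves, one for the arc out of position `k` and one for the
-- arc into value `k`. In each half the arc either stays open, which makes the condition stricter,
-- or is deleted. After the renumbering the open ends are always the first positions and the first
-- values, so only their number has to be remembered.

module PermutationSums where
  open ≡ using (refl; sym; trans; cong; setoid)

  -- Duplicate-free lists with the same elements, and injectivity of insertion.

  module _ {a ℓ} (S : Setoid a ℓ) where
    open Setoid S using (_≈_) renaming (Carrier to A; sym to ≈-sym)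
    open import Data.List.Membership.Setoid S using (_∈_)
    open import Data.List.Relation.Binary.Permutation.Setoid S
    open Permutation S

    -- The head of `xs` occurs in `ys` and can be shifted to the front there; uniqueness keeps it
    -- out of both remainders, so the two inclusions restrict to them. This is what makes a sum over
    -- permutations independent of the chosen enumeration.
    unique-⊆⊇⇒↭ : ∀ {xs ys : List A} → Unique S xs → Unique S ys →
                  (∀ {z} → z ∈ xs → z ∈ ys) → (∀ {z} → z ∈ ys → z ∈ xs) → xs ↭ ys
    unique-⊆⊇⇒↭ {[]} {[]}    _ _ _ _ = ↭-refl
    unique-⊆⊇⇒↭ {[]} {y ∷ _} _ _ _ ⊇ = contradiction (⊇ (here (Setoid.refl S))) λ ()
    unique-⊆⊇⇒↭ {x ∷ xs} {ys} (x∉xs ∷ xs!) ys! ⊆ ⊇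
      with ps , qs , w , x≈w , ys≋ ← SetoidMembership.∈-∃++ S (⊆ (here (Setoid.refl S))) =
      ↭-trans (prep (Setoid.refl S) (unique-⊆⊇⇒↭ xs! ps++qs! ⊆′ ⊇′)) (↭-sym ys↭)
      where
      ys↭ : ys ↭ x ∷ ps ++ qs
      ys↭ = ↭-trans (↭-reflexive-≋ ys≋) (shift (≈-sym x≈w) ps qs)

      ys!′ : Unique S (x ∷ ps ++ qs)
      ys!′ = Unique-resp-↭ ys↭ ys!

      ps++qs! : Unique S (ps ++ qs)
      ps++qs! with _ ∷ u ← ys!′ = u

      x∉ps++qs : All (λ z → ¬ x ≈ z) (ps ++ qs)
      x∉ps++qs with u ∷ _ ← ys!′ = u

      ⊆′ : ∀ {z} → z ∈ xs → z ∈ ps ++ qs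
      ⊆′ z∈xs with ∈-resp-↭ ys↭ (⊆ (there z∈xs))
      ... | here z≈x  = contradiction (SetoidMembership.∈-resp-≈ S z≈x z∈xs) (SetoidMembership.All[≉]⇒∉ S x∉xs)
      ... | there z∈  = z∈

      ⊇′ : ∀ {z} → z ∈ ps ++ qs → z ∈ xs
      ⊇′ z∈ with ⊇ (∈-resp-↭ (↭-sym ys↭) (there z∈))
      ... | here z≈x   = contradiction (SetoidMembership.∈-resp-≈ S z≈x z∈) (SetoidMembership.All[≉]⇒∉ S x∉ps++qs)
      ... | there z∈xs = z∈xs

  ⟨$⟩ʳ-injective : ∀ {n} (π : Permutation′ n) {x y} → π ⟨$⟩ʳ x ≡ π ⟨$⟩ʳ y → x ≡ y
  ⟨$⟩ʳ-injective π e = trans (sym (Perm.inverseˡ π)) (trans (cong (π ⟨$⟩ˡ_) e) (Perm.inverseˡ π))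

  insert-at : ∀ {n} i j (π : Permutation′ n) → insert i j π ⟨$⟩ʳ i ≡ j
  insert-at i j π with i Fin.≟ i
  ... | yes _ = refl
  ... | no i≢i = contradiction refl i≢i

  insert-respects-≈ : ∀ {n} {i i′ j j′ : Fin (suc n)} {π ρ : Permutation′ n} →
                      i ≡ i′ → j ≡ j′ → π Perm.≈ ρ →
                      insert i j π Perm.≈ insert i′ j′ ρ
  insert-respects-≈ {i = i} {j = j} refl refl p x with i Fin.≟ x
  ... | yes _ = refl
  ... | no  _ = cong (punchIn j) (p _)

  insert-injectiveʳ : ∀ {n} {i j k : Fin (suc n)} {π ρ : Permutation′ n} →
                      insert i j π Perm.≈ insert i k ρ → j ≡ k × π Perm.≈ ρ
  insert-injectiveʳ {i = i} {j} {k} {π} {ρ} p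
    with refl ← trans (sym (insert-at i j π)) (trans (p i) (insert-at i k ρ)) =
    refl , λ x → punchIn-injective j _ _
      (trans (sym (insert-punchIn i j π x))
             (trans (p (punchIn i x)) (insert-punchIn i j ρ x)))

  insert-injectiveˡ : ∀ {n} {i j k : Fin (suc n)} {π ρ : Permutation′ n} →
                      insert i k π Perm.≈ insert j k ρ → i ≡ j × π Perm.≈ ρ
  insert-injectiveˡ {i = i} {j} {k} {π} {ρ} p
    with refl ← ⟨$⟩ʳ-injective (insert i k π)
      (trans (insert-at i k π) (sym (trans (p j) (insert-at j k ρ)))) =
    refl , proj₂ (insert-injectiveʳ {i = i} {π = π} {ρ} p)

  -- Sums over all permutations, expanded along a position or a value.

  module _ {c ℓ} (M : CommutativeMonoid c ℓ) where
    open CommutativeMonoid M renaming (_∙_ to _+_; ε to 0#; setoid to M-setoid)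
      hiding (refl; sym; trans)
    private module M = CommutativeMonoid M
    open import Algebra.Properties.CommutativeMonoid.Sum M using (sum)

    listSum : ∀ {a} {A : Set a} → (A → Carrier) → List A → Carrier
    listSum f xs = foldr _+_ 0# (map f xs)

    listSum-cong : ∀ {a} {A : Set a} {f g : A → Carrier} → (∀ x → f x ≈ g x) →
                   ∀ xs → listSum f xs ≈ listSum g xs
    listSum-cong f≈g []       = M.refl
    listSum-cong f≈g (x ∷ xs) = ∙-cong (f≈g x) (listSum-cong f≈g xs)

    listSum-++ : ∀ {a} {A : Set a} (f : A → Carrier) xs ys →
                 listSum f (xs ++ ys) ≈ listSum f xs + listSum f ys
    listSum-++ f []       ys = M.sym (identityˡ _)
    listSum-++ f (x ∷ xs) ys = M.trans (∙-congˡ (listSum-++ f xs ys)) (M.sym (assoc _ _ _))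

    listSum-cartesianProductWith :
      ∀ {a b d} {A : Set a} {B : Set b} {D : Set d} (f : D → Carrier) (g : A → B → D) xs ys →
      listSum f (cartesianProductWith g xs ys) ≈ listSum (λ x → listSum (λ y → f (g x y)) ys) xs
    listSum-cartesianProductWith f g []       ys = M.refl
    listSum-cartesianProductWith f g (x ∷ xs) ys =
      M.trans (listSum-++ f (map (g x) ys) _)
              (∙-cong (M.reflexive (cong (foldr _+_ 0#) (sym (List.map-∘ ys))))
                      (listSum-cartesianProductWith f g xs ys))

    listSum-tabulate : ∀ {a} {A : Set a} {n} (f : A → Carrier) (g : Fin n → A) →
                       listSum f (tabulate g) ≡ sum (f ∘ g)
    listSum-tabulate {n = zero}  f g = refl
    listSum-tabulate {n = suc n} f g = cong (f (g zero) +_) (listSum-tabulate f (g ∘ suc))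

    listSum-allFin : ∀ {n} (f : Fin n → Carrier) → listSum f (allFin n) ≡ sum f
    listSum-allFin f = listSum-tabulate f id

    permSum : ∀ n → (Permutation′ n → Carrier) → Carrier
    permSum n f = listSum f (permutations n)

    module _ {n} {f : Permutation′ n → Carrier} (f-cong : ∀ {π ρ} → π Perm.≈ ρ → f π ≈ f ρ) where

      -- Two duplicate-free enumerations agree only up to rearrangement and pointwise equality of
      -- permutations, hence the commutative monoid and the condition `f-cong`.
      permSum-enumeration : ∀ {xs} → IsEnumeration (≈-setoid n) xs → Unique (≈-setoid n) xs →
                            permSum n f ≈ listSum f xs
      permSum-enumeration {xs} enum uniq =
        Permutation.foldr-commMonoid M-setoid isCommutativeMonoid
          (Permutation.map⁺ (≈-setoid n) M-setoid f-cong
            (unique-⊆⊇⇒↭ (≈-setoid n) (permutations-unique n) uniq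
              (λ {z} _ → enum z) (λ {z} _ → permutations-enumerates n z)))

    module _ {n} {f : Permutation′ (suc n) → Carrier}
             (f-cong : ∀ {π ρ} → π Perm.≈ ρ → f π ≈ f ρ) where

      private
        S = ≈-setoid (suc n)

        expand : (ins : Fin (suc n) → Permutation′ n → Permutation′ (suc n)) →
                 IsEnumeration S (cartesianProductWith ins (allFin (suc n)) (permutations n)) →
                 Unique S (cartesianProductWith ins (allFin (suc n)) (permutations n)) →
                 permSum (suc n) f ≈ sum (λ i → permSum n (f ∘ ins i))
        expand ins enum uniq = M.trans (permSum-enumeration f-cong enum uniq)
          (M.trans (listSum-cartesianProductWith f ins (allFin (suc n)) (permutations n))
                   (M.reflexive (listSum-allFin (λ i → permSum n (f ∘ ins i)))))

      -- Inserting all values at one fixed position enumerates the permutations without repetition,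
      -- just as `permutations` does at position `zero`.
      permSum-expand-position : ∀ i → permSum (suc n) f ≈ sum (λ j → permSum n (f ∘ insert i j))
      permSum-expand-position i = expand (insert i)
        (λ σ → SetoidMembership.∈-resp-≈ S
          {x = insert i (σ ⟨$⟩ʳ i) (remove i σ)} {y = σ} (insert-remove i σ)
          (SetoidMembership.∈-cartesianProductWith⁺ (setoid _) (≈-setoid n) S
            (λ {_} {_} {π} {ρ} → insert-respects-≈ {i = i} {π = π} {ρ} refl)
            (Membership.∈-allFin (σ ⟨$⟩ʳ i)) (permutations-enumerates n (remove i σ))))
        (SetoidUnique.cartesianProductWith⁺ (setoid _) (≈-setoid n) S (insert i)
          (λ {_} {_} {π} {ρ} → insert-injectiveʳ {i = i} {π = π} {ρ})
          (Unique.allFin⁺ (suc n)) (permutations-unique n))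

      permSum-expand-value : ∀ j → permSum (suc n) f ≈ sum (λ i → permSum n (f ∘ λ π → insert i j π))
      permSum-expand-value j = expand (λ i → insert i j)
        (λ σ → let i = σ ⟨$⟩ˡ j; ρ = remove i σ in SetoidMembership.∈-resp-≈ S
          {x = insert i j ρ} {y = σ}
          (λ x → trans (insert-respects-≈ {i = i} {π = ρ} {ρ} refl (sym (Perm.inverseʳ σ)) (λ _ → refl) x)
                       (insert-remove i σ x))
          (SetoidMembership.∈-cartesianProductWith⁺ (setoid _) (≈-setoid n) S
            (λ {_} {_} {π} {ρ} e → insert-respects-≈ {π = π} {ρ} e refl)
            (Membership.∈-allFin i) (permutations-enumerates n ρ)))
        (SetoidUnique.cartesianProductWith⁺ (setoid _) (≈-setoid n) S (λ i → insert i j)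
          (λ {_} {_} {π} {ρ} → insert-injectiveˡ {π = π} {ρ})
          (Unique.allFin⁺ (suc n)) (permutations-unique n))

-- Weak excedances and crossings under deletion of an arc.

module Statistics where
  open PermutationSums
  open import Data.Nat.Base using (_+_)
  open ≡ using (refl; sym; trans; cong; cong₂; subst₂)
  open import Algebra.Properties.CommutativeMonoid.Sum ℕ.+-0-commutativeMonoid
    using (sum; sum-cong-≗; sum-remove; sum-permute; ∑-distrib-+; sum-replicate-zero)

  private
    variable
      m n : ℕ

  ι : ∀ {p} {P : Set p} → Dec P → ℕ
  ι d = if does d then 1 else 0

  ι-yes : ∀ {p} {P : Set p} → P → (d : Dec P) → ι d ≡ 1
  ι-yes p (yes _) = refl
  ι-yes p (no ¬p) = contradiction p ¬p

  ι-no : ∀ {p} {P : Set p} → ¬ P → (d : Dec P) → ι d ≡ 0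
  ι-no ¬p (yes p) = contradiction p ¬p
  ι-no ¬p (no _)  = refl

  ι-cong : ∀ {p q} {P : Set p} {Q : Set q} → (P → Q) → (Q → P) →
           (d : Dec P) (e : Dec Q) → ι d ≡ ι e
  ι-cong f g (yes p) e = sym (ι-yes (f p) e)
  ι-cong f g (no ¬p) e = sym (ι-no (¬p ∘ g) e)

  length-filter : ∀ {a p} {A : Set a} {P : Pred A p} (P? : Decidable P) xs →
                  length (filter P? xs) ≡ listSum ℕ.+-0-commutativeMonoid (ι ∘ P?) xs
  length-filter P? []       = refl
  length-filter P? (x ∷ xs) with does (P? x)
  ... | true  = cong suc (length-filter P? xs)
  ... | false = length-filter P? xs

  length-filter-allFin : ∀ {p} {P : Pred (Fin n) p} (P? : Decidable P) →
                         length (filter P? (allFin n)) ≡ sum (ι ∘ P?)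
  length-filter-allFin P? =
    trans (length-filter P? (allFin _)) (listSum-allFin ℕ.+-0-commutativeMonoid (ι ∘ P?))

  sum-zero : {f : Fin n → ℕ} → (∀ i → f i ≡ 0) → sum f ≡ 0
  sum-zero {n = n} f≡0 = trans (sum-cong-≗ f≡0) (sum-replicate-zero n)

  -- Such counts become the exponents of `q` freed by a deleted arc. Truncated subtraction covers
  -- the empty interval.
  count-interval : ∀ m a b → b ℕ.≤ m →
    sum {m} (λ z → ι (a ℕ.≤? toℕ z ×-dec toℕ z ℕ.<? b)) ≡ b ∸ a
  count-interval zero    a       zero    _ = sym (ℕ.0∸n≡0 a)
  count-interval (suc m) a       zero    _ =
    trans (sum-zero {suc m} (λ z → ι-no (λ ()) (a ℕ.≤? toℕ z ×-dec toℕ z ℕ.<? 0))) (sym (ℕ.0∸n≡0 a))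
  count-interval (suc m) zero    (suc b) (s≤s b≤m) = cong suc
    (trans (sum-cong-≗ {m} λ z → ι-cong (λ (_ , p) → z≤n , ℕ.≤-pred p) (λ (_ , p) → z≤n , s≤s p)
             (0 ℕ.≤? suc (toℕ z) ×-dec suc (toℕ z) ℕ.<? suc b) (0 ℕ.≤? toℕ z ×-dec toℕ z ℕ.<? b))
           (count-interval m zero b b≤m))
  count-interval (suc m) (suc a) (suc b) (s≤s b≤m) =
    trans (sum-cong-≗ {m} λ z → ι-cong (λ (r , p) → ℕ.≤-pred r , ℕ.≤-pred p) (λ (r , p) → s≤s r , s≤s p)
            (suc a ℕ.≤? suc (toℕ z) ×-dec suc (toℕ z) ℕ.<? suc b) (a ℕ.≤? toℕ z ×-dec toℕ z ℕ.<? b))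
          (count-interval m a b b≤m)

  -- (j , v) and (i , w) are the arcs j ↦ v and i ↦ w.
  Upper Lower : (j v i w : Fin n) → Set
  Upper j v i w = j < i × i ≤ v × v < w
  Lower j v i w = i < j × v < i × w < v

  upper? : (j v i w : Fin n) → Dec (Upper j v i w)
  upper? j v i w = j <? i ×-dec (i ≤? v ×-dec v <? w)

  lower? : (j v i w : Fin n) → Dec (Lower j v i w)
  lower? j v i w = i <? j ×-dec (v <? i ×-dec w <? v)

  crossing : (j v i w : Fin n) → ℕ
  crossing j v i w = ι (upper? j v i w) + ι (lower? j v i w)

  crossing-no : (j v i w : Fin n) → ¬ Upper j v i w → ¬ Lower j v i w → crossing j v i w ≡ 0
  crossing-no j v i w ¬u ¬l = cong₂ _+_ (ι-no ¬u (upper? j v i w)) (ι-no ¬l (lower? j v i w))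

  wex-sum : (σ : Permutation′ n) → wex σ ≡ sum (λ i → ι (i ≤? (σ ⟨$⟩ʳ i)))
  wex-sum σ = length-filter-allFin (λ i → i ≤? (σ ⟨$⟩ʳ i))

  -- With upper and lower crossings merged, `cr` is one double sum over ordered pairs of arcs, so
  -- that deleting an arc removes one row and one column.
  cr-sum : (σ : Permutation′ n) →
           cr σ ≡ sum (λ i → sum (λ j → crossing j (σ ⟨$⟩ʳ j) i (σ ⟨$⟩ʳ i)))
  cr-sum {n} σ = trans (cong₂ _+_ (part upper?) (part lower?)) (trans (sym (∑-distrib-+ {n} _ _))
    (sum-cong-≗ {n} λ i → sym (∑-distrib-+ {n} _ _)))
    where
    part : {P : (j v i w : Fin n) → Set} (P? : ∀ j v i w → Dec (P j v i w)) →
      ℕ.sum (map (λ i → length (filter (λ j → P? j (σ ⟨$⟩ʳ j) i (σ ⟨$⟩ʳ i)) (allFin n))) (allFin n))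
      ≡ sum (λ i → sum (λ j → ι (P? j (σ ⟨$⟩ʳ j) i (σ ⟨$⟩ʳ i))))
    part P? = trans
      (listSum-allFin ℕ.+-0-commutativeMonoid
        (λ i → length (filter (λ j → P? j (σ ⟨$⟩ʳ j) i (σ ⟨$⟩ʳ i)) (allFin n))))
      (sum-cong-≗ {n} λ i → length-filter-allFin (λ j → P? j (σ ⟨$⟩ʳ j) i (σ ⟨$⟩ʳ i)))

  wex-cong : {π ρ : Permutation′ n} → π Perm.≈ ρ → wex π ≡ wex ρ
  wex-cong {n} {π} {ρ} π≈ρ = trans (wex-sum π)
    (trans (sum-cong-≗ {n} λ i → cong (λ v → ι (i ≤? v)) (π≈ρ i)) (sym (wex-sum ρ)))

  cr-cong : {π ρ : Permutation′ n} → π Perm.≈ ρ → cr π ≡ cr ρ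
  cr-cong {n} {π} {ρ} π≈ρ = trans (cr-sum π)
    (trans (sum-cong-≗ {n} λ i → sum-cong-≗ {n} λ j → cong₂ (λ v w → crossing j v i w) (π≈ρ j) (π≈ρ i))
           (sym (cr-sum ρ)))

  -- Order comparisons under `punchIn`.

  punchIn-view : (i : Fin (suc n)) (x : Fin n) →
    (toℕ x ℕ.< toℕ i × toℕ (punchIn i x) ≡ toℕ x) ⊎
    (toℕ i ℕ.≤ toℕ x × toℕ (punchIn i x) ≡ suc (toℕ x))
  punchIn-view zero    x    = inj₂ (z≤n , refl)
  punchIn-view (suc i) zero = inj₁ (s≤s z≤n , refl)
  punchIn-view (suc i) (suc x) with punchIn-view i x
  ... | inj₁ (x<i , e) = inj₁ (s≤s x<i , cong suc e)
  ... | inj₂ (i≤x , e) = inj₂ (s≤s i≤x , cong suc e)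

  punchIn-mono-< : ∀ (i : Fin (suc n)) {x y} → x < y → punchIn i x < punchIn i y
  punchIn-mono-< i {x} {y} x<y = ℕ.≰⇒> λ py≤px → ℕ.<⇒≱ x<y (punchIn-cancel-≤ i y x py≤px)

  punchIn-cancel-< : ∀ (i : Fin (suc n)) {x y} → punchIn i x < punchIn i y → x < y
  punchIn-cancel-< i {x} {y} px<py = ℕ.≰⇒> λ y≤x → ℕ.<⇒≱ px<py (punchIn-mono-≤ i y x y≤x)

  punchIn-≤-suc : ∀ (i : Fin (suc n)) x → toℕ (punchIn i x) ℕ.≤ suc (toℕ x)
  punchIn-≤-suc i x with punchIn-view i x
  ... | inj₁ (_ , e) = ℕ.≤-trans (ℕ.≤-reflexive e) (ℕ.n≤1+n _)
  ... | inj₂ (_ , e) = ℕ.≤-reflexive e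

  ≤-punchIn : ∀ (i : Fin (suc n)) x → toℕ x ℕ.≤ toℕ (punchIn i x)
  ≤-punchIn i x with punchIn-view i x
  ... | inj₁ (_ , e) = ℕ.≤-reflexive (sym e)
  ... | inj₂ (_ , e) = ℕ.≤-trans (ℕ.n≤1+n _) (ℕ.≤-reflexive (sym e))

  punchIn-≥ : ∀ {i : Fin (suc n)} {x} → toℕ i ℕ.≤ toℕ x → toℕ (punchIn i x) ≡ suc (toℕ x)
  punchIn-≥ {i = i} {x} i≤x with punchIn-view i x
  ... | inj₁ (x<i , _) = contradiction i≤x (ℕ.<⇒≱ x<i)
  ... | inj₂ (_ , e)   = e

  punchIn-< : ∀ {i : Fin (suc n)} {x} → toℕ x ℕ.< toℕ i → toℕ (punchIn i x) ≡ toℕ x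
  punchIn-< {i = i} {x} x<i with punchIn-view i x
  ... | inj₁ (_ , e)   = e
  ... | inj₂ (i≤x , _) = contradiction i≤x (ℕ.<⇒≱ x<i)

  pred≤⇒≤suc : ∀ m {l} → pred m ℕ.≤ l → m ℕ.≤ suc l
  pred≤⇒≤suc zero    _ = z≤n
  pred≤⇒≤suc (suc m) p = s≤s p

  -- A case split on `i ≡ j` whose second branch presents `j` as `punchIn i x`, the form to which
  -- `insert-punchIn` applies.
  data Position (i : Fin (suc n)) : Fin (suc n) → Set where
    here  : Position i i
    there : ∀ x → Position i (punchIn i x)

  position : ∀ (i j : Fin (suc n)) → Position i j
  position zero zero = here
  position zero (suc j) = there j
  position {suc n} (suc i) zero = there zero
  position {suc n} (suc i) (suc j) with position i j
  ... | here    = here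
  ... | there x = there (suc x)

  -- In a left-to-right scan of a larger permutation, the first a positions stand
  -- for the open upper arcs and the first b values for the open lower arcs; these
  -- must not be joined to one another.
  Avoids : ℕ → ℕ → Permutation′ n → Set
  Avoids a b σ = ∀ i → toℕ i ℕ.< a → b ℕ.≤ toℕ (σ ⟨$⟩ʳ i)

  avoids? : ∀ a b (σ : Permutation′ n) → Dec (Avoids a b σ)
  avoids? a b σ = all? λ i → (toℕ i ℕ.<? a) →-dec (b ℕ.≤? toℕ (σ ⟨$⟩ʳ i))

  -- The two order hypotheses ask that comparing a position with a value be stable under the
  -- renumbering, but only for positions from `a` on or values from `b` on. Avoidance ensures that
  -- `wex` and `cr` depend on no other comparison.
  module Insert (i v : Fin (suc n)) (π : Permutation′ n) (a b : ℕ)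
    (≤-punchIn⁺ : ∀ x w → a ℕ.≤ toℕ x ⊎ b ℕ.≤ toℕ w → x ≤ w → punchIn i x ≤ punchIn v w)
    (≤-punchIn⁻ : ∀ x w → a ℕ.≤ toℕ x ⊎ b ℕ.≤ toℕ w → punchIn i x ≤ punchIn v w → x ≤ w)
    (avoids : Avoids a b π) where

    τ : Permutation′ (suc n)
    τ = insert i v π

    private
      source : (x : Fin n) → a ℕ.≤ toℕ x ⊎ b ℕ.≤ toℕ (π ⟨$⟩ʳ x)
      source x with a ℕ.≤? toℕ x
      ... | yes a≤x = inj₁ a≤x
      ... | no  a≰x = inj₂ (avoids x (ℕ.≰⇒> a≰x))

      -- An upper crossing compares a position `z` with the value of an arc starting at `x < z`; a
      -- lower bound on `x` passes on to `z`.
      source-< : (x : Fin n) {z : Fin n} → x < z → a ℕ.≤ toℕ z ⊎ b ℕ.≤ toℕ (π ⟨$⟩ʳ x)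
      source-< x x<z with source x
      ... | inj₁ a≤x = inj₁ (ℕ.≤-trans a≤x (ℕ.<⇒≤ x<z))
      ... | inj₂ b≤  = inj₂ b≤

      -- A lower crossing compares the position `x` with a value `w` above the value at `x`; a lower
      -- bound on that value passes on to `w`.
      source-> : (x : Fin n) {w : Fin n} → (π ⟨$⟩ʳ x) < w → a ℕ.≤ toℕ x ⊎ b ℕ.≤ toℕ w
      source-> x πx<w with source x
      ... | inj₁ a≤x = inj₁ a≤x
      ... | inj₂ b≤  = inj₂ (ℕ.≤-trans b≤ (ℕ.<⇒≤ πx<w))

    wex-insert : wex τ ≡ ι (i ≤? v) + wex π
    wex-insert = trans (wex-sum τ) (trans (sum-remove {n} {i} (λ x → ι (x ≤? (τ ⟨$⟩ʳ x)))) (cong₂ _+_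
      (cong (λ w → ι (i ≤? w)) (insert-at i v π))
      (trans (sum-cong-≗ {n} λ x → trans
               (cong (λ w → ι (punchIn i x ≤? w)) (insert-punchIn i v π x))
               (ι-cong (≤-punchIn⁻ x (π ⟨$⟩ʳ x) (source x)) (≤-punchIn⁺ x (π ⟨$⟩ʳ x) (source x))
                       (punchIn i x ≤? punchIn v (π ⟨$⟩ʳ x)) (x ≤? (π ⟨$⟩ʳ x))))
             (sym (wex-sum π)))))

    private
      crossing-punchIn : ∀ x z →
        crossing (punchIn i x) (punchIn v (π ⟨$⟩ʳ x)) (punchIn i z) (punchIn v (π ⟨$⟩ʳ z)) ≡
        crossing x (π ⟨$⟩ʳ x) z (π ⟨$⟩ʳ z)
      crossing-punchIn x z = cong₂ _+_
        (ι-cong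
          (λ (p , q , r) → let x<z = punchIn-cancel-< i p in
            x<z , ≤-punchIn⁻ z (π ⟨$⟩ʳ x) (source-< x x<z) q , punchIn-cancel-< v r)
          (λ (p , q , r) → punchIn-mono-< i p , ≤-punchIn⁺ z (π ⟨$⟩ʳ x) (source-< x p) q , punchIn-mono-< v r)
          (upper? (punchIn i x) (punchIn v (π ⟨$⟩ʳ x)) (punchIn i z) (punchIn v (π ⟨$⟩ʳ z)))
          (upper? x (π ⟨$⟩ʳ x) z (π ⟨$⟩ʳ z)))
        (ι-cong
          (λ (p , q , r) → let w<v = punchIn-cancel-< v r in punchIn-cancel-< i p ,
            ℕ.≰⇒> (λ z≤ → ℕ.<⇒≱ q (≤-punchIn⁺ z (π ⟨$⟩ʳ x) (source-> z w<v) z≤)) , w<v)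
          (λ (p , q , r) → punchIn-mono-< i p ,
            ℕ.≰⇒> (λ z≤ → ℕ.<⇒≱ q (≤-punchIn⁻ z (π ⟨$⟩ʳ x) (source-> z r) z≤)) , punchIn-mono-< v r)
          (lower? (punchIn i x) (punchIn v (π ⟨$⟩ʳ x)) (punchIn i z) (punchIn v (π ⟨$⟩ʳ z)))
          (lower? x (π ⟨$⟩ʳ x) z (π ⟨$⟩ʳ z)))

    -- The double sum is split into the pairs in which the new arc comes second, those in which it
    -- comes first, and those not involving it. The last are preserved by the renumbering.
    cr-insert : cr τ ≡
      sum (λ z → crossing z (τ ⟨$⟩ʳ z) i v) +
      (sum (λ z → crossing i v z (τ ⟨$⟩ʳ z)) + cr π)
    cr-insert = begin
      cr τ
        ≡⟨ cr-sum τ ⟩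
      sum (λ w → sum (λ z → C z w))
        ≡⟨ sum-remove {n} {i} (λ w → sum (λ z → C z w)) ⟩
      sum (λ z → C z i) + sum {n} (λ x → sum (λ z → C z (punchIn i x)))
        ≡⟨ cong₂ _+_ (sum-cong-≗ {suc n} λ z → cong (crossing z (τ ⟨$⟩ʳ z) i) (insert-at i v π))
                     (sum-cong-≗ {n} λ x → sum-remove {n} {i} (λ z → C z (punchIn i x))) ⟩
      second + sum {n} (λ x → C i (punchIn i x) + sum {n} (λ z → C (punchIn i z) (punchIn i x)))
        ≡⟨ cong (second +_) (∑-distrib-+ {n} (λ x → C i (punchIn i x)) _) ⟩
      second + (sum {n} (λ x → C i (punchIn i x)) + sum {n} (λ x → sum {n} (λ z → C (punchIn i z) (punchIn i x))))
        ≡⟨ cong (second +_) (cong₂ _+_ first≡ (trans rest≡ (sym (cr-sum π)))) ⟩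
      second + (first + cr π) ∎
      where
      open ≡-Reasoning
      C : (z w : Fin (suc n)) → ℕ
      C z w = crossing z (τ ⟨$⟩ʳ z) w (τ ⟨$⟩ʳ w)
      second = sum (λ z → crossing z (τ ⟨$⟩ʳ z) i v)
      first  = sum (λ z → crossing i v z (τ ⟨$⟩ʳ z))
      first≡ : sum {n} (λ x → C i (punchIn i x)) ≡ first
      -- An arc does not cross itself, so the term `z = i` may be added, and the sum can later be
      -- counted over all of `Fin (suc n)`.
      first≡ = sym (trans (sum-remove {n} {i} (λ z → crossing i v z (τ ⟨$⟩ʳ z))) (cong₂ _+_
        (crossing-no i v i (τ ⟨$⟩ʳ i) (λ (p , _) → ℕ.<-irrefl refl p) (λ (p , _) → ℕ.<-irrefl refl p))
        (sum-cong-≗ {n} λ x → cong (λ w → crossing i w (punchIn i x) (τ ⟨$⟩ʳ punchIn i x))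
                                 (sym (insert-at i v π)))))
      rest≡ : sum {n} (λ x → sum {n} (λ z → C (punchIn i z) (punchIn i x))) ≡
              sum (λ x → sum (λ z → crossing z (π ⟨$⟩ʳ z) x (π ⟨$⟩ʳ x)))
      rest≡ = sum-cong-≗ {n} λ x → sum-cong-≗ {n} λ z → trans
        (cong₂ (λ s t → crossing (punchIn i z) s (punchIn i x) t)
               (insert-punchIn i v π z) (insert-punchIn i v π x))
        (crossing-punchIn z x)

  -- The open upper arc from i (or a new one, if i ≡ k) ends at k.
  module InsertValue (i k : Fin (suc n)) (i≤k : i ≤ k) (π : Permutation′ n) where

    τ : Permutation′ (suc n)
    τ = insert i k π

    avoids⁺ : Avoids (toℕ k) (toℕ k) π → Avoids (suc (toℕ k)) (toℕ k) τ
    avoids⁺ av z (s≤s z≤k) with position i z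
    ... | here    = ℕ.≤-reflexive (cong toℕ (sym (insert-at i k π)))
    ... | there x = ℕ.≤-trans (av x x<k) (ℕ.≤-trans (≤-punchIn k _)
          (ℕ.≤-reflexive (cong toℕ (sym (insert-punchIn i k π x)))))
      where
      x<k : toℕ x ℕ.< toℕ k
      x<k with punchIn-view i x
      ... | inj₁ (x<i , _) = ℕ.<-≤-trans x<i i≤k
      ... | inj₂ (_ , e)   = ℕ.≤-trans (ℕ.≤-reflexive (sym e)) z≤k

    avoids⁻ : Avoids (suc (toℕ k)) (toℕ k) τ → Avoids (toℕ k) (toℕ k) π
    avoids⁻ av x x<k with punchIn-view k (π ⟨$⟩ʳ x)
    ... | inj₂ (k≤ , _) = k≤
    ... | inj₁ (_ , e)  = ℕ.≤-trans
      (av (punchIn i x) (s≤s (ℕ.≤-trans (punchIn-≤-suc i x) x<k)))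
      (ℕ.≤-reflexive (trans (cong toℕ (insert-punchIn i k π x)) e))

    -- Keeps the two alternatives of the recurrence disjoint: a closed arc is not counted among the
    -- open ones.
    ¬avoids : ¬ Avoids (suc (toℕ k)) (suc (toℕ k)) τ
    ¬avoids av = ℕ.<-irrefl (cong toℕ (sym (insert-at i k π))) (av i (s≤s i≤k))

    module _ (av : Avoids (toℕ k) (toℕ k) π) where

      private
        -- Together with `x ≤ w`, either alternative gives `k ≤ w`; then `w` moves up by one, while
        -- `x` moves by at most one.
        ≤-punchIn⁺ : ∀ x w → toℕ k ℕ.≤ toℕ x ⊎ toℕ k ℕ.≤ toℕ w → x ≤ w → punchIn i x ≤ punchIn k w
        ≤-punchIn⁺ x w p x≤w = ℕ.≤-trans (punchIn-≤-suc i x) (ℕ.≤-trans (s≤s x≤w)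
          (ℕ.≤-reflexive (sym (punchIn-≥ (k≤w p)))))
          where
          k≤w : toℕ k ℕ.≤ toℕ x ⊎ toℕ k ℕ.≤ toℕ w → toℕ k ℕ.≤ toℕ w
          k≤w (inj₁ k≤x) = ℕ.≤-trans k≤x x≤w
          k≤w (inj₂ k≤w) = k≤w

        ≤-punchIn⁻ : ∀ x w → toℕ k ℕ.≤ toℕ x ⊎ toℕ k ℕ.≤ toℕ w → punchIn i x ≤ punchIn k w → x ≤ w
        ≤-punchIn⁻ x w _ le with punchIn-view i x | punchIn-view k w
        ... | inj₁ (x<i , _) | inj₂ (k≤w , _) = ℕ.≤-trans (ℕ.<⇒≤ x<i) (ℕ.≤-trans i≤k k≤w)
        ... | inj₁ (_ , e)   | inj₁ (_ , f)   = subst₂ ℕ._≤_ e f le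
        ... | inj₂ (_ , e)   | inj₁ (_ , f)   = ℕ.<⇒≤ (subst₂ ℕ._≤_ e f le)
        ... | inj₂ (_ , e)   | inj₂ (_ , f)   = ℕ.≤-pred (subst₂ ℕ._≤_ e f le)

        module I = Insert i k π (toℕ k) (toℕ k) ≤-punchIn⁺ ≤-punchIn⁻ av

      wex-insert : wex τ ≡ suc (wex π)
      wex-insert = trans I.wex-insert (cong (_+ wex π) (ι-yes i≤k (i ≤? k)))

      -- The arc from `i` is crossed exactly by the arcs starting at `z` with `i < z ≤ k`: these are
      -- still open and hence end strictly beyond `k`. In the second role it has no crossings, since
      -- arcs starting before `i` do not end below `k`, and `i ≤ k` excludes lower crossings.
      cr-insert : cr τ ≡ (toℕ k ∸ toℕ i) + cr π
      cr-insert = trans I.cr-insert (cong₂ _+_ second≡0 (cong (_+ cr π) first≡))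
        where
        second≡0 : sum (λ z → crossing z (τ ⟨$⟩ʳ z) i k) ≡ 0
        second≡0 = sum-zero {suc n} λ z → crossing-no z _ i k
          (λ (z<i , _ , <k) → ℕ.<⇒≱ <k (avoids⁺ av z (ℕ.<-trans z<i (s≤s i≤k))))
          (λ (_ , τz<i , k<τz) → ℕ.<⇒≱ (ℕ.<-trans k<τz τz<i) i≤k)

        k<τ : ∀ z → i < z → z ≤ k → k < (τ ⟨$⟩ʳ z)
        k<τ z i<z z≤k = ℕ.≤∧≢⇒< (avoids⁺ av z (s≤s z≤k)) λ k≡τz →
          ℕ.<-irrefl (cong toℕ (⟨$⟩ʳ-injective τ (trans (insert-at i k π) (toℕ-injective k≡τz)))) i<z

        first≡ : sum (λ z → crossing i k z (τ ⟨$⟩ʳ z)) ≡ toℕ k ∸ toℕ i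
        first≡ = trans (sum-cong-≗ {suc n} λ z → trans
            (cong₂ _+_
              (ι-cong (λ (i<z , z≤k , _) → i<z , s≤s z≤k)
                      (λ (i<z , z<1+k) → i<z , ℕ.≤-pred z<1+k , k<τ z i<z (ℕ.≤-pred z<1+k))
                      (upper? i k z (τ ⟨$⟩ʳ z))
                      (suc (toℕ i) ℕ.≤? toℕ z ×-dec toℕ z ℕ.<? suc (toℕ k)))
              (ι-no (λ (z<i , k<z , _) → ℕ.<⇒≱ (ℕ.<-trans k<z z<i) i≤k) (lower? i k z (τ ⟨$⟩ʳ z))))
            (ℕ.+-identityʳ _))
          (count-interval (suc n) (suc (toℕ i)) (suc (toℕ k)) (toℕ<n k))

  -- The open lower arc ending at s starts at k.
  module InsertPosition (k s : Fin (suc n)) (s<k : s < k) (π : Permutation′ n) where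

    τ : Permutation′ (suc n)
    τ = insert k s π

    -- Deleting the value `s < k` lowers all values above it by one, so the bound `k` on the values
    -- of the first `k` positions becomes `pred k`.
    avoids⁺ : Avoids (toℕ k) (pred (toℕ k)) π → Avoids (toℕ k) (toℕ k) τ
    avoids⁺ av z z<k with position k z
    ... | here    = contradiction z<k (ℕ.<-irrefl refl)
    ... | there x = ℕ.≤-trans k≤1+πx (ℕ.≤-reflexive (sym
          (trans (cong toℕ (insert-punchIn k s π x)) (punchIn-≥ (ℕ.≤-pred (ℕ.≤-trans s<k k≤1+πx))))))
      where
      k≤1+πx : toℕ k ℕ.≤ suc (toℕ (π ⟨$⟩ʳ x))
      k≤1+πx = pred≤⇒≤suc (toℕ k) (av x (ℕ.≤-<-trans (≤-punchIn k x) z<k))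

    avoids⁻ : Avoids (toℕ k) (toℕ k) τ → Avoids (toℕ k) (pred (toℕ k)) π
    avoids⁻ av x x<k = ℕ.pred-mono-≤ (ℕ.≤-trans
      (av (punchIn k x) (ℕ.≤-<-trans (ℕ.≤-reflexive (punchIn-< x<k)) x<k))
      (ℕ.≤-trans (ℕ.≤-reflexive (cong toℕ (insert-punchIn k s π x))) (punchIn-≤-suc s _)))

    ¬avoids : ¬ Avoids (suc (toℕ k)) (toℕ k) τ
    ¬avoids av = ℕ.<⇒≱ s<k (ℕ.≤-trans (av k ℕ.≤-refl) (ℕ.≤-reflexive (cong toℕ (insert-at k s π))))

    module _ (av : Avoids (toℕ k) (pred (toℕ k)) π) where

      private
        ≤-punchIn⁺ : ∀ x w → toℕ k ℕ.≤ toℕ x ⊎ pred (toℕ k) ℕ.≤ toℕ w → x ≤ w → punchIn k x ≤ punchIn s w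
        ≤-punchIn⁺ x w _ x≤w with punchIn-view k x
        ... | inj₁ (_ , e)   = ℕ.≤-trans (ℕ.≤-reflexive e) (ℕ.≤-trans x≤w (≤-punchIn s w))
        ... | inj₂ (k≤x , e) = ℕ.≤-trans (ℕ.≤-reflexive e) (ℕ.≤-trans (s≤s x≤w)
          (ℕ.≤-reflexive (sym (punchIn-≥ (ℕ.≤-trans (ℕ.<⇒≤ s<k) (ℕ.≤-trans k≤x x≤w))))))

        -- For `x < k` only the alternative about `w` remains, and it gives `x ≤ pred k ≤ w`
        -- outright. Otherwise `x` moves up by exactly one and `w` by at most one.
        ≤-punchIn⁻ : ∀ x w → toℕ k ℕ.≤ toℕ x ⊎ pred (toℕ k) ℕ.≤ toℕ w → punchIn k x ≤ punchIn s w → x ≤ w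
        ≤-punchIn⁻ x w p le with punchIn-view k x | p
        ... | inj₁ (x<k , _) | inj₁ k≤x = contradiction k≤x (ℕ.<⇒≱ x<k)
        ... | inj₁ (x<k , _) | inj₂ k≤w = ℕ.≤-trans (ℕ.pred-mono-≤ x<k) k≤w
        ... | inj₂ (_ , e)   | _        = ℕ.≤-pred (ℕ.≤-trans (ℕ.≤-reflexive (sym e))
                                                              (ℕ.≤-trans le (punchIn-≤-suc s w)))

        module I = Insert k s π (toℕ k) (pred (toℕ k)) ≤-punchIn⁺ ≤-punchIn⁻ av

      wex-insert : wex τ ≡ wex π
      wex-insert = trans I.wex-insert (cong (_+ wex π) (ι-no (ℕ.<⇒≱ s<k) (k ≤? s)))

      -- The values strictly between `s` and `k` cannot come from positions before `k`, which avoid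
      -- them, nor from `k` itself. Each is thus the end of an arc starting after `k`, and exactly
      -- these arcs cross the inserted one.
      cr-insert : cr τ ≡ (toℕ k ∸ suc (toℕ s)) + cr π
      cr-insert = trans I.cr-insert (cong₂ _+_ second≡ (cong (_+ cr π) first≡0))
        where
        first≡0 : sum (λ z → crossing k s z (τ ⟨$⟩ʳ z)) ≡ 0
        first≡0 = sum-zero {suc n} λ z → crossing-no k s z _
          (λ (k<z , z≤s , _) → ℕ.<⇒≱ (ℕ.<-trans s<k k<z) z≤s)
          (λ (z<k , s<z , τz<s) → ℕ.<⇒≱ (ℕ.<-trans τz<s s<k) (avoids⁺ av z z<k))

        k<z : ∀ z → s < (τ ⟨$⟩ʳ z) → (τ ⟨$⟩ʳ z) < k → k < z
        k<z z s<τz τz<k = ℕ.≰⇒> λ z≤k → ℕ.<⇒≱ τz<k (avoids⁺ av z (ℕ.≤∧≢⇒< z≤k λ z≡k →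
          ℕ.<-irrefl (cong toℕ (sym (trans (cong (τ ⟨$⟩ʳ_) (toℕ-injective z≡k)) (insert-at k s π)))) s<τz))

        second≡ : sum (λ z → crossing z (τ ⟨$⟩ʳ z) k s) ≡ toℕ k ∸ suc (toℕ s)
        second≡ = trans (sum-cong-≗ {suc n} λ z → cong₂ _+_
            (ι-no (λ (z<k , k≤τz , τz<s) → ℕ.<⇒≱ (ℕ.<-trans τz<s s<k) k≤τz) (upper? z (τ ⟨$⟩ʳ z) k s))
            (ι-cong (λ (_ , τz<k , s<τz) → s<τz , τz<k)
                    (λ (s<τz , τz<k) → k<z z s<τz τz<k , τz<k , s<τz)
                    (lower? z (τ ⟨$⟩ʳ z) k s)
                    (suc (toℕ s) ℕ.≤? toℕ (τ ⟨$⟩ʳ z) ×-dec toℕ (τ ⟨$⟩ʳ z) ℕ.<? toℕ k)))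
          -- The condition concerns only the value at `z`, so the sum is reindexed by values through
          -- the bijection `τ`.
          (trans (sym (sum-permute {suc n} (λ v → ι (suc (toℕ s) ℕ.≤? toℕ v ×-dec toℕ v ℕ.<? toℕ k)) τ))
                 (count-interval (suc n) (suc (toℕ s)) (toℕ k) (ℕ.<⇒≤ (toℕ<n k))))

module Orthogonality {c ℓ} {R : CommutativeRing c ℓ} (P : Parameters R) where
  open PermutationSums
  open Statistics
  open CommutativeRing R hiding (zero)
  open Parameters P
  open QLaguerre P
  open Polynomial R
  open import Algebra.Properties.Semiring.Exp semiring using (_^_; ^-homo-*; ^-congʳ)
  open import Algebra.Properties.Semiring.Sum semiring
    using (sum; sum-cong-≋; ∑-distrib-+; *-distribˡ-sum; *-distribʳ-sum)
  open import Algebra.Properties.Ring ring using (-1*x≈-x; -‿distribʳ-*; -‿involutive)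
  open import Algebra.Properties.CommutativeSemigroup +-commutativeSemigroup using (interchange)
  open import Algebra.Properties.CommutativeSemigroup *-commutativeSemigroup
    using (x∙yz≈y∙xz) renaming (interchange to *-interchange)
  open import Algebra.Solver.Ring.NaturalCoefficients.Default commutativeSemiring
    using (solve; _:=_; _:+_; _:*_; con)
  open import Relation.Binary.Reasoning.Setoid setoid

  -- q-integers as sums of powers of q.

  ⟦suc⟧ : ∀ n → ⟦ suc n ⟧ ≈ q ^ n + ⟦ n ⟧
  ⟦suc⟧ n = begin
    (1# - q * q ^ n) * ⟨1-q⟩⁻¹                               ≈⟨ *-congʳ split ⟩
    (q ^ n * (1# - q) + (1# - q ^ n)) * ⟨1-q⟩⁻¹              ≈⟨ distribʳ _ _ _ ⟩
    q ^ n * (1# - q) * ⟨1-q⟩⁻¹ + ⟦ n ⟧                       ≈⟨ +-congʳ (*-assoc _ _ _) ⟩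
    q ^ n * ((1# - q) * ⟨1-q⟩⁻¹) + ⟦ n ⟧
      ≈⟨ +-congʳ (*-congˡ (proj₂ (proj₂ 1-q-invertible))) ⟩
    q ^ n * 1# + ⟦ n ⟧                                       ≈⟨ +-congʳ (*-identityʳ _) ⟩
    q ^ n + ⟦ n ⟧                                            ∎
    where
    split : 1# - q * q ^ n ≈ q ^ n * (1# - q) + (1# - q ^ n)
    split = sym (begin
      q ^ n * (1# - q) + (1# - q ^ n)
        ≈⟨ +-congʳ (trans (distribˡ _ _ _)
             (+-cong (*-identityʳ _) (trans (sym (-‿distribʳ-* _ _)) (-‿cong (*-comm _ _))))) ⟩
      (q ^ n - q * q ^ n) + (1# - q ^ n)   ≈⟨ +-cong (+-comm _ _) (+-comm _ _) ⟩
      (- (q * q ^ n) + q ^ n) + (- q ^ n + 1#)   ≈⟨ +-assoc _ _ _ ⟩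
      - (q * q ^ n) + (q ^ n + (- q ^ n + 1#))   ≈⟨ +-congˡ (+-assoc _ _ _) ⟨
      - (q * q ^ n) + ((q ^ n - q ^ n) + 1#)   ≈⟨ +-congˡ (trans (+-congʳ (-‿inverseʳ _)) (+-identityˡ _)) ⟩
      - (q * q ^ n) + 1#   ≈⟨ +-comm _ _ ⟩
      1# - q * q ^ n ∎)

  ⟦0⟧ : ⟦ 0 ⟧ ≈ 0#
  ⟦0⟧ = trans (*-congʳ (-‿inverseʳ 1#)) (zeroˡ _)

  -- The power of `q` freed when the `i`-th of `b` candidate ends is chosen. It vanishes from `b`
  -- on, so that sums may run over all of `Fin n`.
  gap : ∀ {n} → ℕ → Fin n → Carrier
  gap b i = if does (toℕ i ℕ.<? b) then q ^ (b ∸ suc (toℕ i)) else 0#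

  -- For `i < b` the exponents run through `b - 1`, ..., `0`, each once.
  sum-gap : ∀ n b → b ℕ.≤ n → sum {n} (gap b) ≈ ⟦ b ⟧
  sum-gap zero    zero    _         = sym ⟦0⟧
  sum-gap (suc n) zero    _         = trans (+-identityˡ _) (sum-gap n zero z≤n)
  sum-gap (suc n) (suc b) (s≤s b≤n) = trans (+-congˡ (sum-gap n b b≤n)) (sym (⟦suc⟧ b))

  if-cong : ∀ {p r} {P : Set p} {Q : Set r} {x y : Carrier} →
            (P → Q) → (Q → P) → (Q → x ≈ y) → (d : Dec P) (e : Dec Q) →
            (if does d then x else 0#) ≈ (if does e then y else 0#)
  if-cong f g x≈y (yes p) (yes r) = x≈y r
  if-cong f g x≈y (yes p) (no ¬r) = contradiction (f p) ¬r
  if-cong f g x≈y (no ¬p) (yes r) = contradiction (g r) ¬p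
  if-cong f g x≈y (no ¬p) (no ¬r) = refl

  if-yes : ∀ {p} {P : Set p} {x y : Carrier} → P → (d : Dec P) → (if does d then x else y) ≈ x
  if-yes p (yes _) = refl
  if-yes p (no ¬p) = contradiction p ¬p

  if-no : ∀ {p} {P : Set p} {x y : Carrier} → ¬ P → (d : Dec P) → (if does d then x else y) ≈ y
  if-no ¬p (yes p) = contradiction p ¬p
  if-no ¬p (no _)  = refl

  if-* : ∀ (b : Bool) x y → (if b then x * y else 0#) ≈ x * (if b then y else 0#)
  if-* true  x y = refl
  if-* false x y = sym (zeroʳ x)

  -- The recurrence for sums of weights.

  weight : ∀ {n} → Permutation′ n → Carrier
  weight σ = y ^ wex σ * q ^ cr σ

  -- Excluded permutations get weight zero instead of being removed from the list, so the expansions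
  -- of `permSum` apply unchanged.
  restricted : ∀ {n} → ℕ → ℕ → Permutation′ n → Carrier
  restricted a b σ = if does (avoids? a b σ) then weight σ else 0#

  restricted-cong : ∀ {n} a b {π ρ : Permutation′ n} → π Perm.≈ ρ → restricted a b π ≈ restricted a b ρ
  restricted-cong a b {π} {ρ} π≈ρ = if-cong
    (λ av i i<a → ≡.subst (λ v → b ℕ.≤ toℕ v) (π≈ρ i) (av i i<a))
    (λ av i i<a → ≡.subst (λ v → b ℕ.≤ toℕ v) (≡.sym (π≈ρ i)) (av i i<a))
    (λ _ → reflexive (≡.cong₂ (λ s t → y ^ s * q ^ t) (wex-cong {π = π} {ρ} π≈ρ) (cr-cong {π = π} {ρ} π≈ρ)))
    (avoids? a b π) (avoids? a b ρ)

  -- At most one summand on the right survives. For `i ≤ k` the arc into `k` violates the stricter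
  -- condition, and deleting it gives the second summand. For `i > k` no pending position has value
  -- `k`, so both conditions agree and `gap` is zero.
  restricted-insert-value : ∀ {n} (i k : Fin (suc n)) (π : Permutation′ n) →
    restricted (suc (toℕ k)) (toℕ k) (insert i k π) ≈
    restricted (suc (toℕ k)) (suc (toℕ k)) (insert i k π) +
    y * gap (suc (toℕ k)) i * restricted (toℕ k) (toℕ k) π
  restricted-insert-value i k π = by-cases (toℕ i ℕ.≤? toℕ k)
    where
    κ = toℕ k
    τ = insert i k π
    by-cases : Dec (toℕ i ℕ.≤ κ) →
      restricted (suc κ) κ τ ≈ restricted (suc κ) (suc κ) τ + y * gap (suc κ) i * restricted κ κ π
    by-cases (yes i≤k) = begin
      restricted (suc κ) κ τ
        ≈⟨ if-cong (avoids⁻) (avoids⁺) weight-τ (avoids? (suc κ) κ τ) (avoids? κ κ π) ⟩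
      (if does (avoids? κ κ π) then y * q ^ (κ ∸ toℕ i) * weight π else 0#)
        ≈⟨ if-* (does (avoids? κ κ π)) _ _ ⟩
      y * q ^ (κ ∸ toℕ i) * restricted κ κ π
        ≈⟨ *-congʳ (*-congˡ (if-yes (s≤s i≤k) (toℕ i ℕ.<? suc κ))) ⟨
      y * gap (suc κ) i * restricted κ κ π
        ≈⟨ +-identityˡ _ ⟨
      0# + y * gap (suc κ) i * restricted κ κ π
        ≈⟨ +-congʳ (if-no ¬avoids (avoids? (suc κ) (suc κ) τ)) ⟨
      restricted (suc κ) (suc κ) τ + y * gap (suc κ) i * restricted κ κ π ∎
      where
      open InsertValue i k i≤k π using (avoids⁺; avoids⁻; ¬avoids; wex-insert; cr-insert)
      weight-τ : Avoids κ κ π → weight τ ≈ y * q ^ (κ ∸ toℕ i) * weight π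
      weight-τ av = begin
        y ^ wex τ * q ^ cr τ
          ≈⟨ *-cong (^-congʳ y (wex-insert av))
                   (trans (^-congʳ q (cr-insert av)) (^-homo-* q (κ ∸ toℕ i) (cr π))) ⟩
        (y * y ^ wex π) * (q ^ (κ ∸ toℕ i) * q ^ cr π)
          ≈⟨ *-interchange _ _ _ _ ⟩
        y * q ^ (κ ∸ toℕ i) * weight π ∎
    by-cases (no i≰k) = begin
      restricted (suc κ) κ τ
        ≈⟨ if-cong raise lower (λ _ → refl) (avoids? (suc κ) κ τ) (avoids? (suc κ) (suc κ) τ) ⟩
      restricted (suc κ) (suc κ) τ
        ≈⟨ +-identityʳ _ ⟨
      restricted (suc κ) (suc κ) τ + 0#
        ≈⟨ +-congˡ (trans (*-congʳ (trans
             (*-congˡ (if-no (i≰k ∘ ℕ.≤-pred) (toℕ i ℕ.<? suc κ))) (zeroʳ _))) (zeroˡ _)) ⟨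
      restricted (suc κ) (suc κ) τ + y * gap (suc κ) i * restricted κ κ π ∎
      where
      raise : Avoids (suc κ) κ τ → Avoids (suc κ) (suc κ) τ
      raise av z z≤k = ℕ.≤∧≢⇒< (av z z≤k) λ k≡τz → i≰k (ℕ.≤-trans (ℕ.≤-reflexive (≡.cong toℕ
        (⟨$⟩ʳ-injective τ (≡.trans (insert-at i k π) (toℕ-injective k≡τz))))) (ℕ.≤-pred z≤k))
      lower : Avoids (suc κ) (suc κ) τ → Avoids (suc κ) κ τ
      lower av z z≤k = ℕ.<⇒≤ (av z z≤k)

  -- For `s < k` position `k` violates the stricter condition, and its arc is deleted. For `s ≥ k`
  -- the extra requirement on position `k` holds already, and `gap` is zero.
  restricted-insert-position : ∀ {n} (k s : Fin (suc n)) (π : Permutation′ n) →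
    restricted (toℕ k) (toℕ k) (insert k s π) ≈
    restricted (suc (toℕ k)) (toℕ k) (insert k s π) +
    gap (toℕ k) s * restricted (toℕ k) (pred (toℕ k)) π
  restricted-insert-position k s π = by-cases (toℕ s ℕ.<? toℕ k)
    where
    κ = toℕ k
    τ = insert k s π
    by-cases : Dec (toℕ s ℕ.< κ) →
      restricted κ κ τ ≈ restricted (suc κ) κ τ + gap κ s * restricted κ (pred κ) π
    by-cases (yes s<k) = begin
      restricted κ κ τ
        ≈⟨ if-cong (avoids⁻) (avoids⁺) weight-τ (avoids? κ κ τ) (avoids? κ (pred κ) π) ⟩
      (if does (avoids? κ (pred κ) π) then q ^ (κ ∸ suc (toℕ s)) * weight π else 0#)
        ≈⟨ if-* (does (avoids? κ (pred κ) π)) _ _ ⟩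
      q ^ (κ ∸ suc (toℕ s)) * restricted κ (pred κ) π
        ≈⟨ *-congʳ (if-yes s<k (toℕ s ℕ.<? κ)) ⟨
      gap κ s * restricted κ (pred κ) π
        ≈⟨ +-identityˡ _ ⟨
      0# + gap κ s * restricted κ (pred κ) π
        ≈⟨ +-congʳ (if-no ¬avoids (avoids? (suc κ) κ τ)) ⟨
      restricted (suc κ) κ τ + gap κ s * restricted κ (pred κ) π ∎
      where
      open InsertPosition k s s<k π using (avoids⁺; avoids⁻; ¬avoids; wex-insert; cr-insert)
      weight-τ : Avoids κ (pred κ) π → weight τ ≈ q ^ (κ ∸ suc (toℕ s)) * weight π
      weight-τ av = begin
        y ^ wex τ * q ^ cr τ
          ≈⟨ *-cong (^-congʳ y (wex-insert av))
                   (trans (^-congʳ q (cr-insert av)) (^-homo-* q (κ ∸ suc (toℕ s)) (cr π))) ⟩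
        y ^ wex π * (q ^ (κ ∸ suc (toℕ s)) * q ^ cr π)
          ≈⟨ x∙yz≈y∙xz _ _ _ ⟩
        q ^ (κ ∸ suc (toℕ s)) * weight π ∎
    by-cases (no s≮k) = begin
      restricted κ κ τ
        ≈⟨ if-cong extend (λ av z z<k → av z (ℕ.m<n⇒m<1+n z<k)) (λ _ → refl)
                   (avoids? κ κ τ) (avoids? (suc κ) κ τ) ⟩
      restricted (suc κ) κ τ
        ≈⟨ +-identityʳ _ ⟨
      restricted (suc κ) κ τ + 0#
        ≈⟨ +-congˡ (trans (*-congʳ (if-no s≮k (toℕ s ℕ.<? κ))) (zeroˡ _)) ⟨
      restricted (suc κ) κ τ + gap κ s * restricted κ (pred κ) π ∎
      where
      extend : Avoids κ κ τ → Avoids (suc κ) κ τ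
      extend av z z≤k with position k z
      ... | here    = ℕ.≤-trans (ℕ.≮⇒≥ s≮k) (ℕ.≤-reflexive (≡.cong toℕ (≡.sym (insert-at k s π))))
      ... | there x = av _ (ℕ.≤∧≢⇒< (ℕ.≤-pred z≤k) λ e → punchInᵢ≢i k x (toℕ-injective e))

  private
    listSum-linear : ∀ {a} {A : Set a} (f g : A → Carrier) x (xs : List A) →
      listSum +-commutativeMonoid (λ σ → f σ + x * g σ) xs ≈
      listSum +-commutativeMonoid f xs + x * listSum +-commutativeMonoid g xs
    listSum-linear f g x []       = sym (trans (+-identityˡ _) (zeroʳ x))
    listSum-linear f g x (σ ∷ σs) = trans (+-congˡ (listSum-linear f g x σs))
      (trans (interchange _ _ _ _) (+-congˡ (sym (distribˡ _ _ _))))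

  -- The case `a = b + 1` is the state between the two halves of a scan step: the current position
  -- has been treated, the current value has not.
  W : ℕ → ℕ → ℕ → Carrier
  W a b n = permSum +-commutativeMonoid n (restricted a b)

  private
    sum-restricted : ∀ {n} a b a′ b′ (ins : Fin (suc n) → Permutation′ n → Permutation′ (suc n))
      (g : Fin (suc n) → Carrier) {a″ b″} →
      (∀ i π → restricted a b (ins i π) ≈ restricted a′ b′ (ins i π) + g i * restricted a″ b″ π) →
      sum (λ i → permSum +-commutativeMonoid n (restricted a b ∘ ins i)) ≈
      sum (λ i → permSum +-commutativeMonoid n (restricted a′ b′ ∘ ins i)) + sum g * W a″ b″ n
    sum-restricted {n} a b a′ b′ ins g {a″} {b″} eq = begin
      sum (λ i → permSum +-commutativeMonoid n (restricted a b ∘ ins i))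
        ≈⟨ sum-cong-≋ {suc n} (λ i → trans (listSum-cong +-commutativeMonoid (eq i) (permutations n))
             (listSum-linear (restricted a′ b′ ∘ ins i) (restricted a″ b″) (g i) (permutations n))) ⟩
      sum (λ i → permSum +-commutativeMonoid n (restricted a′ b′ ∘ ins i) + g i * W a″ b″ n)
        ≈⟨ ∑-distrib-+ {suc n} (λ i → permSum +-commutativeMonoid n (restricted a′ b′ ∘ ins i))
                             (λ i → g i * W a″ b″ n) ⟩
      sum (λ i → permSum +-commutativeMonoid n (restricted a′ b′ ∘ ins i)) + sum (λ i → g i * W a″ b″ n)
        ≈⟨ +-congˡ (*-distribʳ-sum (W a″ b″ n) g) ⟨
      sum (λ i → permSum +-commutativeMonoid n (restricted a′ b′ ∘ ins i)) + sum g * W a″ b″ n ∎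

  -- Expansion along the value `k`. It stays open, or receives an arc from one of `k + 1` positions:
  -- the `k` open ones and `k` itself. Every such arc is a weak excedance, whence the factor `y`.
  W-value : ∀ n k → k ℕ.≤ n → W (suc k) k (suc n) ≈ W (suc k) (suc k) (suc n) + y * ⟦ suc k ⟧ * W k k n
  -- Presents `k` as `toℕ κ`, the form in which the insertion lemmas speak of it.
  W-value n k k≤n with fromℕ< (s≤s k≤n) | toℕ-fromℕ< (s≤s k≤n)
  ... | κ | ≡.refl = begin
    W (suc k) k (suc n)
      ≈⟨ permSum-expand-value +-commutativeMonoid (λ {π} {ρ} → restricted-cong _ _ {π} {ρ}) κ ⟩
    sum (λ i → permSum +-commutativeMonoid n (λ π → restricted (suc k) k (insert i κ π)))
      ≈⟨ sum-restricted (suc k) k (suc k) (suc k) (λ i → insert i κ) (λ i → y * gap (suc k) i)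
           (λ i π → restricted-insert-value i κ π) ⟩
    sum (λ i → permSum +-commutativeMonoid n (λ π → restricted (suc k) (suc k) (insert i κ π))) +
    sum {suc n} (λ i → y * gap (suc k) i) * W k k n
      ≈⟨ +-cong (permSum-expand-value +-commutativeMonoid (λ {π} {ρ} → restricted-cong _ _ {π} {ρ}) κ)
                (*-congʳ (trans (*-congˡ (sym (sum-gap (suc n) (suc k) (s≤s k≤n))))
                                 (*-distribˡ-sum y (gap {suc n} (suc k))))) ⟨
    W (suc k) (suc k) (suc n) + y * ⟦ suc k ⟧ * W k k n ∎

  -- Expansion along the position `k`. Its arc stays open, or ends at one of the `k` open values and
  -- contributes no `y`. For `k = 0` the truncated `pred` is harmless because `⟦ 0 ⟧` vanishes.
  W-position : ∀ n k → k ℕ.≤ n → W k k (suc n) ≈ W (suc k) k (suc n) + ⟦ k ⟧ * W k (pred k) n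
  W-position n k k≤n with fromℕ< (s≤s k≤n) | toℕ-fromℕ< (s≤s k≤n)
  ... | κ | ≡.refl = begin
    W k k (suc n)
      ≈⟨ permSum-expand-position +-commutativeMonoid (λ {π} {ρ} → restricted-cong _ _ {π} {ρ}) κ ⟩
    sum (λ i → permSum +-commutativeMonoid n (λ π → restricted k k (insert κ i π)))
      ≈⟨ sum-restricted k k (suc k) k (λ i → insert κ i) (gap k)
           (λ i π → restricted-insert-position κ i π) ⟩
    sum (λ i → permSum +-commutativeMonoid n (λ π → restricted (suc k) k (insert κ i π))) +
    sum {suc n} (gap k) * W k (pred k) n
      ≈⟨ +-cong (permSum-expand-position +-commutativeMonoid (λ {π} {ρ} → restricted-cong _ _ {π} {ρ}) κ)
                (*-congʳ (sym (sum-gap (suc n) k (ℕ.m≤n⇒m≤1+n k≤n)))) ⟨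
    W (suc k) k (suc n) + ⟦ k ⟧ * W k (pred k) n ∎

  W-0-0 : ∀ n → W 0 0 n ≈ μ n
  W-0-0 n = listSum-cong +-commutativeMonoid (λ σ → if-yes (λ _ _ → z≤n) (avoids? 0 0 σ)) (permutations n)

  -- Arcs are still open but nothing is left to scan: position `zero` would need a value outside
  -- `Fin (suc k)`.
  W-closed : ∀ k → W (suc k) (suc k) (suc k) ≈ 0#
  W-closed k = trans (listSum-cong +-commutativeMonoid
      (λ σ → if-no (λ av → ℕ.<⇒≱ (toℕ<n (σ ⟨$⟩ʳ zero)) (av zero (s≤s z≤n))) (avoids? (suc k) (suc k) σ))
      (permutations (suc k)))
    (listSum-zero (permutations (suc k)))
    where
    listSum-zero : ∀ {a} {A : Set a} (xs : List A) → listSum +-commutativeMonoid (λ _ → 0#) xs ≈ 0#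
    listSum-zero []       = refl
    listSum-zero (_ ∷ xs) = trans (+-identityˡ _) (listSum-zero xs)

  -- Polynomials of operators on sequences.

  Seq : Set c
  Seq = ℕ → Carrier

  infix 4 _≐_
  _≐_ : Seq → Seq → Set ℓ
  v ≐ w = ∀ k → v k ≈ w k

  record Linear (T : Seq → Seq) : Set (c ⊔ ℓ) where
    field
      resp : ∀ {v w} → v ≐ w → T v ≐ T w
      add  : ∀ v w → T (λ k → v k + w k) ≐ (λ k → T v k + T w k)
      mul  : ∀ a v → T (λ k → a * v k) ≐ (λ k → a * T v k)

    zer : ∀ k → T (λ _ → 0#) k ≈ 0#
    zer k = trans (resp (λ _ → sym (zeroˡ 0#)) k) (trans (mul 0# (λ _ → 0#) k) (zeroˡ _))

  -- Applying `T` innermost first makes the shift of moments in `functional` agree definitionally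
  -- with replacing `v` by `T v`.
  iter : (Seq → Seq) → ℕ → Seq → Seq
  iter T zero    v = v
  iter T (suc m) v = iter T m (T v)

  iter-suc : ∀ T m v → iter T (suc m) v ≡ T (iter T m v)
  iter-suc T zero    v = ≡.refl
  iter-suc T (suc m) v = iter-suc T m (T v)

  -- p evaluated at the operator T.
  act : (Seq → Seq) → Poly → Seq → Seq
  act T p v k = functional (λ m → iter T m v k) p

  functional-congˡ : ∀ {μ ν : Seq} p → μ ≐ ν → functional μ p ≈ functional ν p
  functional-congˡ []      μ≐ν = refl
  functional-congˡ (a ∷ p) μ≐ν = +-cong (*-congˡ (μ≐ν 0)) (functional-congˡ p (λ k → μ≐ν (suc k)))

  module _ {T : Seq → Seq} (T-lin : Linear T) where
    open Linear T-lin

    act-linear : ∀ p → Linear (act T p)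
    act-linear []      = record
      { resp = λ _ _ → refl ; add = λ _ _ _ → sym (+-identityˡ _) ; mul = λ a _ _ → sym (zeroʳ a) }
    act-linear (a ∷ p) = record
      { resp = λ v≐w k → +-cong (*-congˡ (v≐w k)) (I.resp (resp v≐w) k)
      ; add  = λ v w k → trans
          (+-cong (distribˡ _ _ _) (trans (I.resp (add v w) k) (I.add (T v) (T w) k)))
          (interchange _ _ _ _)
      ; mul  = λ b v k → trans
          (+-cong (x∙yz≈y∙xz _ _ _) (trans (I.resp (mul b v) k) (I.mul b (T v) k)))
          (sym (distribˡ _ _ _))
      }
      where module I = Linear (act-linear p)

    act-comm : ∀ p v → act T p (T v) ≐ T (act T p v)
    act-comm []      v k = sym (zer k)
    act-comm (a ∷ p) v k = sym (trans (add (λ j → a * v j) (act T p (T v)) k)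
      (+-cong (mul a v k) (sym (act-comm p (T v) k))))

    act-* : ∀ p r v → act T (p *ₚ r) v ≐ act T p (act T r v)
    act-* []      r v k = refl
    act-* (a ∷ p) r v k = begin
      functional _ (a ·ₚ r +ₚ (0# ∷ p *ₚ r))
        ≈⟨ functional-+ _ (a ·ₚ r) _ ⟩
      functional _ (a ·ₚ r) + (0# * v k + act T (p *ₚ r) (T v) k)
        ≈⟨ +-cong (functional-· _ a r) (trans (+-congʳ (zeroˡ _)) (+-identityˡ _)) ⟩
      a * act T r v k + act T (p *ₚ r) (T v) k
        ≈⟨ +-congˡ (trans (act-* p r (T v) k) (Linear.resp (act-linear p) (act-comm r v) k)) ⟩
      a * act T r v k + act T p (T (act T r v)) k ∎

    act-+ : ∀ p r v → act T (p +ₚ r) v ≐ λ k → act T p v k + act T r v k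
    act-+ p r v k = functional-+ _ p r

    act-· : ∀ a p v → act T (a ·ₚ p) v ≐ λ k → a * act T p v k
    act-· a p v k = functional-· _ a p

    act-const : ∀ a v → act T (const a) v ≐ λ k → a * v k
    act-const a v k = +-identityʳ _

    act-X : ∀ v → act T X v ≐ T v
    act-X v k = trans (+-cong (zeroˡ _) (trans (+-identityʳ _) (*-identityˡ _))) (+-identityˡ _)

  -- Transfers the affine change of variable between `Q` and `L` to operators, so the recurrence of
  -- `Q` can be used at the operator given by the argument.
  act-subst : ∀ {T} (T-lin : Linear T) t p v → act T (p [ t ]) v ≐ act (act T t) p v
  act-subst T-lin t []      v k = refl
  act-subst {T} T-lin t (a ∷ p) v k = begin
    act T (const a +ₚ t *ₚ p [ t ]) v k
      ≈⟨ act-+ T-lin (const a) (t *ₚ p [ t ]) v k ⟩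
    act T (const a) v k + act T (t *ₚ p [ t ]) v k
      ≈⟨ +-cong (act-const T-lin a v k) (act-* T-lin t (p [ t ]) v k) ⟩
    a * v k + S (act T (p [ t ]) v) k
      ≈⟨ +-congˡ (Linear.resp S-lin (act-subst T-lin t p v) k) ⟩
    a * v k + S (act S p v) k
      ≈⟨ +-congˡ (act-comm S-lin p v k) ⟨
    a * v k + act S p (S v) k ∎
    where
    S = act T t
    S-lin = act-linear T-lin t

  -- The coefficients in `L (n + 1) = (x - diag n) L n - offdiag n L (n - 1)`.
  diag offdiag : ℕ → Carrier
  diag n    = y * ⟦ suc n ⟧ + ⟦ n ⟧
  offdiag n = y * (⟦ n ⟧ * ⟦ n ⟧)

  -- The transpose of the Jacobi matrix of the polynomials L.
  J : Seq → Seq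
  J v zero    = v 1 + diag 0 * v 0
  J v (suc k) = v (suc (suc k)) + (diag (suc k) * v (suc k) + offdiag (suc k) * v k)

  J-linear : Linear J
  J-linear = record
    { resp = λ where
        e zero    → +-cong (e 1) (*-congˡ (e 0))
        e (suc k) → +-cong (e _) (+-cong (*-congˡ (e _)) (*-congˡ (e _)))
    ; add  = λ where
        v w zero    → solve 5 (λ a b d e f → (a :+ b) :+ d :* (e :+ f) := (a :+ d :* e) :+ (b :+ d :* f))
                        refl (v 1) (w 1) (diag 0) (v 0) (w 0)
        v w (suc k) → solve 8 (λ a b d e f g h i →
                         (a :+ b) :+ (d :* (e :+ f) :+ g :* (h :+ i)) :=
                         (a :+ (d :* e :+ g :* h)) :+ (b :+ (d :* f :+ g :* i)))
                        refl (v _) (w _) (diag (suc k)) (v _) (w _) (offdiag (suc k)) (v k) (w k)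
    ; mul  = λ where
        a v zero    → solve 4 (λ a b d e → a :* b :+ d :* (a :* e) := a :* (b :+ d :* e))
                        refl a (v 1) (diag 0) (v 0)
        a v (suc k) → solve 6 (λ a b d e f g → a :* b :+ (d :* (a :* e) :+ f :* (a :* g)) :=
                                             a :* (b :+ (d :* e :+ f :* g)))
                        refl a (v _) (diag (suc k)) (v _) (offdiag (suc k)) (v k)
    }

  module J = Linear J-linear

  -- From the recurrence of Q to the recurrence of L.

  -1² : - 1# * - 1# ≈ 1#
  -1² = trans (-1*x≈-x _) (-‿involutive 1#)

  -- To the semiring solver `- 1#` is an atom; subtraction is therefore written as multiplication by
  -- it, and cancellation is a separate step.
  cancel : ∀ x → x + - 1# * x ≈ 0#
  cancel x = trans (+-congˡ (-1*x≈-x x)) (-‿inverseʳ x)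

  α β scale half : Carrier
  α     = √y⁻¹
  β     = √y * q
  scale = √y * ⟨q-1⟩⁻¹
  half  = 2⁻¹ * √y⁻¹

  argument : Poly
  argument = half ·ₚ ((q - 1#) ·ₚ X +ₚ const y +ₚ const 1#)

  S : Seq → Seq
  S = act J argument

  S-linear : Linear S
  S-linear = act-linear J-linear argument

  S-eval : ∀ v k → S v k ≈ half * (((q - 1#) * J v k + y * v k) + 1# * v k)
  S-eval v k = trans (act-· J-linear half ((q - 1#) ·ₚ X +ₚ const y +ₚ const 1#) v k) (*-congˡ
    (trans (act-+ J-linear ((q - 1#) ·ₚ X +ₚ const y) (const 1#) v k) (+-cong
      (trans (act-+ J-linear ((q - 1#) ·ₚ X) (const y) v k) (+-cong
        (trans (act-· J-linear (q - 1#) X v k) (*-congˡ (act-X J-linear v k)))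
        (act-const J-linear y v k)))
      (act-const J-linear 1# v k))))

  √y√y⁻¹ : √y * √y⁻¹ ≈ 1#
  √y√y⁻¹ = proj₂ (proj₂ √y-invertible)

  2half : 2# * half ≈ √y⁻¹
  2half = trans (sym (*-assoc _ _ _)) (trans (*-congʳ (proj₂ (proj₂ 2-invertible))) (*-identityˡ _))

  scale-2half : scale * (2# * half) ≈ ⟨q-1⟩⁻¹
  scale-2half = begin
    √y * ⟨q-1⟩⁻¹ * (2# * half) ≈⟨ *-congˡ 2half ⟩
    √y * ⟨q-1⟩⁻¹ * √y⁻¹ ≈⟨ solve 3 (λ a b d → a :* b :* d := b :* (a :* d)) refl √y ⟨q-1⟩⁻¹ √y⁻¹ ⟩
    ⟨q-1⟩⁻¹ * (√y * √y⁻¹) ≈⟨ trans (*-congˡ √y√y⁻¹) (*-identityʳ _) ⟩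
    ⟨q-1⟩⁻¹ ∎

  ⟨q-1⟩⁻¹≈ : ⟨q-1⟩⁻¹ ≈ - 1# * ⟨1-q⟩⁻¹
  ⟨q-1⟩⁻¹≈ = sym (-1*x≈-x _)

  leading : scale * (2# * half) * (q - 1#) ≈ 1#
  leading = begin
    scale * (2# * half) * (q - 1#)         ≈⟨ *-congʳ (trans scale-2half ⟨q-1⟩⁻¹≈) ⟩
    - 1# * ⟨1-q⟩⁻¹ * (q - 1#)
      ≈⟨ solve 3 (λ m i q → m :* i :* (q :+ m) := (m :* m :+ m :* q) :* i) refl (- 1#) ⟨1-q⟩⁻¹ q ⟩
    (- 1# * - 1# + - 1# * q) * ⟨1-q⟩⁻¹     ≈⟨ *-congʳ (+-cong -1² (-1*x≈-x q)) ⟩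
    (1# - q) * ⟨1-q⟩⁻¹                     ≈⟨ proj₂ (proj₂ 1-q-invertible) ⟩
    1#                                     ∎

  scale-sum : scale * (α + β) ≈ - 1# * ⟨1-q⟩⁻¹ * (1# + y * q)
  scale-sum = begin
    √y * ⟨q-1⟩⁻¹ * (√y⁻¹ + √y * q)
      ≈⟨ solve 4 (λ s i t q → s :* i :* (t :+ s :* q) := i :* (s :* t :+ s :* s :* q)) refl √y ⟨q-1⟩⁻¹ √y⁻¹ q ⟩
    ⟨q-1⟩⁻¹ * (√y * √y⁻¹ + √y * √y * q)
      ≈⟨ *-cong ⟨q-1⟩⁻¹≈ (+-cong √y√y⁻¹ (*-congʳ √y*√y≈y)) ⟩
    - 1# * ⟨1-q⟩⁻¹ * (1# + y * q) ∎

  ⟦⟧-neg : ∀ n → ⟦ n ⟧ ≈ (1# + - 1# * q ^ n) * ⟨1-q⟩⁻¹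
  ⟦⟧-neg n = *-congʳ (+-congˡ (sym (-1*x≈-x _)))

  -- After division by `1 - q` this is `(y + 1) - (1 + y q) q^n = y (1 - q^(n+1)) + (1 - q^n)`, up
  -- to the sign.
  diagonal : ∀ n → scale * (2# * half) * (y + 1#) + - 1# * (scale * (α + β) * q ^ n) ≈ - 1# * diag n
  diagonal n = begin
    scale * (2# * half) * (y + 1#) + - 1# * (scale * (α + β) * q ^ n)
      ≈⟨ +-cong (*-congʳ (trans scale-2half ⟨q-1⟩⁻¹≈)) (*-congˡ (*-congʳ scale-sum)) ⟩
    - 1# * ⟨1-q⟩⁻¹ * (y + 1#) + - 1# * (- 1# * ⟨1-q⟩⁻¹ * (1# + y * q) * q ^ n)
      ≈⟨ solve 5 (λ m i y q p → m :* i :* (y :+ con 1) :+ m :* (m :* i :* (con 1 :+ y :* q) :* p) :=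
                   m :* (y :* ((con 1 :+ m :* (q :* p)) :* i) :+ (con 1 :+ m :* p) :* i))
           refl (- 1#) ⟨1-q⟩⁻¹ y q (q ^ n) ⟩
    - 1# * (y * ((1# + - 1# * (q * q ^ n)) * ⟨1-q⟩⁻¹) + (1# + - 1# * q ^ n) * ⟨1-q⟩⁻¹)
      ≈⟨ *-congˡ (+-cong (*-congˡ (⟦⟧-neg (suc n))) (⟦⟧-neg n)) ⟨
    - 1# * diag n ∎

  -- Since `α β = q`, the two factors coincide, and `scale * scale` supplies `y` and the square of
  -- the inverse of `q - 1`, giving `y` times the square of a q-integer.
  offdiagonal : ∀ n → scale * scale * ((1# - q ^ suc n) * (1# - α * β * q ^ n)) ≈ offdiag (suc n)
  offdiagonal n = begin
    scale * scale * ((1# - q ^ suc n) * (1# - α * β * q ^ n))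
      ≈⟨ *-congˡ (*-congˡ (+-congˡ (-‿cong αβqⁿ))) ⟩
    scale * scale * ((1# - q ^ suc n) * (1# - q ^ suc n))
      ≈⟨ solve 3 (λ s i z → (s :* i) :* (s :* i) :* (z :* z) := s :* s :* (i :* i :* (z :* z)))
           refl √y ⟨q-1⟩⁻¹ (1# - q ^ suc n) ⟩
    √y * √y * (⟨q-1⟩⁻¹ * ⟨q-1⟩⁻¹ * ((1# - q ^ suc n) * (1# - q ^ suc n)))
      ≈⟨ *-cong √y*√y≈y (*-congʳ (*-cong ⟨q-1⟩⁻¹≈ ⟨q-1⟩⁻¹≈)) ⟩
    y * (- 1# * ⟨1-q⟩⁻¹ * (- 1# * ⟨1-q⟩⁻¹) * ((1# - q ^ suc n) * (1# - q ^ suc n)))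
      ≈⟨ solve 4 (λ y m i z → y :* (m :* i :* (m :* i) :* (z :* z)) := m :* m :* (y :* (z :* i :* (z :* i))))
           refl y (- 1#) ⟨1-q⟩⁻¹ (1# - q ^ suc n) ⟩
    - 1# * - 1# * offdiag (suc n)
      ≈⟨ trans (*-congʳ -1²) (*-identityˡ _) ⟩
    offdiag (suc n) ∎
    where
    αβqⁿ : α * β * q ^ n ≈ q ^ suc n
    αβqⁿ = begin
      √y⁻¹ * (√y * q) * q ^ n ≈⟨ solve 4 (λ t s q p → t :* (s :* q) :* p := s :* t :* (q :* p)) refl √y⁻¹ √y q (q ^ n) ⟩
      √y * √y⁻¹ * (q * q ^ n) ≈⟨ trans (*-congʳ √y√y⁻¹) (*-identityˡ _) ⟩
      q * q ^ n ∎

  -- A single factor `scale` makes the linear factor of `Q` monic in `J`, with constant term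
  -- `- diag n`.
  act-linear-factor : ∀ n p v k →
    scale * act S ((2# ·ₚ X -ₚ const ((α + β) * q ^ n)) *ₚ p) v k ≈
    J (act S p v) k + - 1# * (diag n * act S p v k)
  act-linear-factor n p v k = begin
    scale * act S ((2# ·ₚ X -ₚ const e) *ₚ p) v k
      ≈⟨ *-congˡ (trans (act-* S-linear (2# ·ₚ X -ₚ const e) p v k)
           (trans (act-+ S-linear (2# ·ₚ X) ((- 1#) ·ₚ const e) u k)
             (+-cong (trans (act-· S-linear 2# X u k) (*-congˡ (trans (act-X S-linear u k) (S-eval u k))))
                     (trans (act-· S-linear (- 1#) (const e) u k) (*-congˡ (act-const S-linear e u k)))))) ⟩
    scale * (2# * (half * (((q - 1#) * J u k + y * u k) + 1# * u k)) + - 1# * ((α + β) * q ^ n * u k))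
      ≈⟨ solve 10 (λ s t h d j y u m ab p →
           s :* (t :* (h :* ((d :* j :+ y :* u) :+ con 1 :* u)) :+ m :* (ab :* p :* u)) :=
           s :* (t :* h) :* d :* j :+ (s :* (t :* h) :* (y :+ con 1) :+ m :* (s :* ab :* p)) :* u)
           refl scale 2# half (q - 1#) (J u k) y (u k) (- 1#) (α + β) (q ^ n) ⟩
    scale * (2# * half) * (q - 1#) * J u k +
    (scale * (2# * half) * (y + 1#) + - 1# * (scale * (α + β) * q ^ n)) * u k
      ≈⟨ +-cong (trans (*-congʳ leading) (*-identityˡ _)) (trans (*-congʳ (diagonal n)) (*-assoc _ _ _)) ⟩
    J u k + - 1# * (diag n * u k) ∎
    where
    u = act S p v
    e = (α + β) * q ^ n

  act-L : ∀ n v k → act J (L n) v k ≈ scale ^ n * act S (Q α β n) v k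
  act-L n v k = trans (act-· J-linear (scale ^ n) (Q α β n [ argument ]) v k)
    (*-congˡ (act-subst J-linear argument (Q α β n) v k))

  act-L-0 : ∀ v k → act J (L 0) v k ≈ v k
  act-L-0 v k = trans (act-L 0 v k) (trans (*-identityˡ _) (trans (act-const S-linear 1# v k) (*-identityˡ _)))

  act-L-1 : ∀ v k → act J (L 1) v k ≈ J v k + - 1# * (diag 0 * v k)
  act-L-1 v k = begin
    act J (L 1) v k                  ≈⟨ act-L 1 v k ⟩
    scale * 1# * act S (Q α β 1) v k ≈⟨ *-congʳ (*-identityʳ _) ⟩
    scale * act S (Q α β 1) v k      ≈⟨ act-linear-factor 0 (Q α β 0) v k ⟩
    J (act S (const 1#) v) k + - 1# * (diag 0 * act S (const 1#) v k)
      ≈⟨ +-cong (J.resp Q₀ k) (*-congˡ (*-congˡ (Q₀ k))) ⟩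
    J v k + - 1# * (diag 0 * v k)    ∎
    where
    Q₀ : act S (const 1#) v ≐ v
    Q₀ j = trans (act-const S-linear 1# v j) (*-identityˡ _)

  -- Of the `n + 2` factors `scale`, one is spent on the linear factor and two on the coefficient of
  -- `Q n`; those left over are the normalisations of `L (n + 1)` and `L n`.
  act-L-suc-suc : ∀ n v k → act J (L (suc (suc n))) v k ≈
    J (act J (L (suc n)) v) k + - 1# * (diag (suc n) * act J (L (suc n)) v k) +
    - 1# * (offdiag (suc n) * act J (L n) v k)
  act-L-suc-suc n v k = begin
    act J (L (suc (suc n))) v k
      ≈⟨ act-L (suc (suc n)) v k ⟩
    scale ^ suc (suc n) * act S (Q α β (suc (suc n))) v k
      ≈⟨ *-congˡ (trans (act-+ S-linear (factor *ₚ Q α β (suc n)) _ v k)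
           (+-congˡ (trans (act-· S-linear (- 1#) (coef ·ₚ Q α β n) v k)
                           (*-congˡ (act-· S-linear coef (Q α β n) v k))))) ⟩
    scale * (scale * scale ^ n) * (act S (factor *ₚ Q α β (suc n)) v k + - 1# * (coef * u₀ k))
      ≈⟨ solve 6 (λ s p a m f u → s :* (s :* p) :* (a :+ m :* (f :* u)) :=
           (s :* p) :* (s :* a) :+ m :* (s :* s :* f :* (p :* u)))
           refl scale (scale ^ n) (act S (factor *ₚ Q α β (suc n)) v k) (- 1#) coef (u₀ k) ⟩
    (scale * scale ^ n) * (scale * act S (factor *ₚ Q α β (suc n)) v k) +
    - 1# * (scale * scale * coef * (scale ^ n * u₀ k))
      ≈⟨ +-cong (*-congˡ (act-linear-factor (suc n) (Q α β (suc n)) v k)) (*-congˡ (*-congʳ (offdiagonal n))) ⟩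
    scale ^ suc n * (J u₁ k + - 1# * (diag (suc n) * u₁ k)) + - 1# * (offdiag (suc n) * (scale ^ n * u₀ k))
      ≈⟨ +-congʳ (solve 5 (λ p j m d u → p :* (j :+ m :* (d :* u)) := p :* j :+ m :* (d :* (p :* u)))
           refl (scale ^ suc n) (J u₁ k) (- 1#) (diag (suc n)) (u₁ k)) ⟩
    scale ^ suc n * J u₁ k + - 1# * (diag (suc n) * (scale ^ suc n * u₁ k)) +
    - 1# * (offdiag (suc n) * (scale ^ n * u₀ k))
      ≈⟨ +-cong (+-cong (trans (J.resp (act-L (suc n) v) k) (J.mul (scale ^ suc n) u₁ k))
                        (*-congˡ (*-congˡ (act-L (suc n) v k))))
                (*-congˡ (*-congˡ (act-L n v k))) ⟨
    J (act J (L (suc n)) v) k + - 1# * (diag (suc n) * act J (L (suc n)) v k) +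
    - 1# * (offdiag (suc n) * act J (L n) v k) ∎
    where
    factor = 2# ·ₚ X -ₚ const ((α + β) * q ^ suc n)
    coef   = (1# - q ^ suc n) * (1# - α * β * q ^ n)
    u₀     = act S (Q α β n) v
    u₁     = act S (Q α β (suc n)) v

  -- The induction needs all `v` at once. Since `L (n + 1)` of `J` commutes with `J`, the hypothesis
  -- applied to `J v` gives `(J v) (n + 1)`; the other two terms of the recurrence subtract all of
  -- it but `v (n + 2)`.
  act-L-at-0 : ∀ n v → act J (L n) v 0 ≈ v n
  act-L-at-0 zero          v = act-L-0 v 0
  act-L-at-0 (suc zero)    v = begin
    act J (L 1) v 0                                   ≈⟨ act-L-1 v 0 ⟩
    v 1 + diag 0 * v 0 + - 1# * (diag 0 * v 0)        ≈⟨ +-assoc _ _ _ ⟩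
    v 1 + (diag 0 * v 0 + - 1# * (diag 0 * v 0))      ≈⟨ trans (+-congˡ (cancel _)) (+-identityʳ _) ⟩
    v 1                                               ∎
  act-L-at-0 (suc (suc n)) v = begin
    act J (L (suc (suc n))) v 0
      ≈⟨ act-L-suc-suc n v 0 ⟩
    J (act J (L (suc n)) v) 0 + - 1# * (diag (suc n) * act J (L (suc n)) v 0) +
    - 1# * (offdiag (suc n) * act J (L n) v 0)
      ≈⟨ +-cong (+-cong (trans (sym (act-comm J-linear (L (suc n)) v 0)) (act-L-at-0 (suc n) (J v)))
                        (*-congˡ (*-congˡ (act-L-at-0 (suc n) v))))
                (*-congˡ (*-congˡ (act-L-at-0 n v))) ⟩
    v (suc (suc n)) + (s + t) + - 1# * s + - 1# * t
      ≈⟨ solve 4 (λ a s t m → a :+ (s :+ t) :+ m :* s :+ m :* t := a :+ ((s :+ m :* s) :+ (t :+ m :* t)))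
           refl _ s t (- 1#) ⟩
    v (suc (suc n)) + ((s + - 1# * s) + (t + - 1# * t))
      ≈⟨ +-congˡ (trans (+-cong (cancel s) (cancel t)) (+-identityˡ _)) ⟩
    v (suc (suc n)) + 0#
      ≈⟨ +-identityʳ _ ⟩
    v (suc (suc n)) ∎
    where
    s = diag (suc n) * v (suc n)
    t = offdiag (suc n) * v n

  -- Columns of J and the norms of L.

  δ-*-cong : ∀ (f : ℕ → Carrier) n k → f k * δ n k ≈ f n * δ n k
  δ-*-cong f zero    zero    = refl
  δ-*-cong f zero    (suc k) = trans (zeroʳ _) (sym (zeroʳ _))
  δ-*-cong f (suc n) zero    = trans (zeroʳ _) (sym (zeroʳ _))
  δ-*-cong f (suc n) (suc k) = δ-*-cong (λ j → f (suc j)) n k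

  J-δ-0 : ∀ k → J (δ 0) k ≈ diag 0 * δ 0 k + offdiag 1 * δ 1 k
  J-δ-0 zero    = trans (+-comm _ _) (+-congˡ (sym (zeroʳ _)))
  J-δ-0 (suc k) = trans (+-identityˡ _)
    (+-cong (trans (zeroʳ _) (sym (zeroʳ _))) (δ-*-cong (λ j → offdiag (suc j)) 0 k))

  J-δ-suc : ∀ n k → J (δ (suc n)) k ≈
    δ n k + (diag (suc n) * δ (suc n) k + offdiag (suc (suc n)) * δ (suc (suc n)) k)
  J-δ-suc n zero    = +-congˡ (trans (zeroʳ _) (sym (trans (+-cong (zeroʳ _) (zeroʳ _)) (+-identityˡ _))))
  J-δ-suc n (suc k) = +-congˡ (+-cong (δ-*-cong (λ j → diag (suc j)) n k)
                                      (δ-*-cong (λ j → offdiag (suc j)) (suc n) k))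

  -- The squared norm of `L n`, as a product of the recurrence coefficients.
  norm : ℕ → Carrier
  norm zero    = 1#
  norm (suc n) = norm n * offdiag (suc n)

  -- `J` sends `δ (n + 1)` to a combination of `δ n`, `δ (n + 1)` and `δ (n + 2)`. The recurrence
  -- cancels the first two, the first because `norm (n + 1)` contains the factor `offdiag (n + 1)`;
  -- the third leaves `norm (n + 2)`.
  act-L-δ-0 : ∀ n k → act J (L n) (δ 0) k ≈ norm n * δ n k
  act-L-δ-0 zero          k = trans (act-L-0 (δ 0) k) (sym (*-identityˡ _))
  act-L-δ-0 (suc zero)    k = begin
    act J (L 1) (δ 0) k                                             ≈⟨ act-L-1 (δ 0) k ⟩
    J (δ 0) k + - 1# * s                                            ≈⟨ +-congʳ (J-δ-0 k) ⟩
    s + offdiag 1 * δ 1 k + - 1# * s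
      ≈⟨ solve 3 (λ s t m → s :+ t :+ m :* s := (s :+ m :* s) :+ t) refl s _ (- 1#) ⟩
    (s + - 1# * s) + offdiag 1 * δ 1 k                              ≈⟨ trans (+-congʳ (cancel s)) (+-identityˡ _) ⟩
    offdiag 1 * δ 1 k                                               ≈⟨ *-congʳ (*-identityˡ _) ⟨
    norm 1 * δ 1 k                                                  ∎
    where s = diag 0 * δ 0 k
  act-L-δ-0 (suc (suc n)) k = begin
    act J (L (suc (suc n))) (δ 0) k
      ≈⟨ act-L-suc-suc n (δ 0) k ⟩
    J (act J (L (suc n)) (δ 0)) k + - 1# * (diag (suc n) * act J (L (suc n)) (δ 0) k) +
    - 1# * (offdiag (suc n) * act J (L n) (δ 0) k)
      ≈⟨ +-cong (+-cong (trans (J.resp (act-L-δ-0 (suc n)) k)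
                               (trans (J.mul (norm (suc n)) (δ (suc n)) k) (*-congˡ (J-δ-suc n k))))
                        (*-congˡ (*-congˡ (act-L-δ-0 (suc n) k))))
                (*-congˡ (*-congˡ (act-L-δ-0 n k))) ⟩
    N * b * (δ n k + (diag (suc n) * d + offdiag (suc (suc n)) * e)) + - 1# * (diag (suc n) * (N * b * d)) +
    - 1# * (b * (N * δ n k))
      ≈⟨ solve 8 (λ N b f a d g e m →
           N :* b :* (f :+ (a :* d :+ g :* e)) :+ m :* (a :* (N :* b :* d)) :+ m :* (b :* (N :* f)) :=
           (N :* b :* f :+ m :* (N :* b :* f)) :+ ((N :* b :* a :* d) :+ m :* (N :* b :* a :* d)) :+ N :* b :* g :* e)
           refl N b (δ n k) (diag (suc n)) d (offdiag (suc (suc n))) e (- 1#) ⟩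
    (N * b * δ n k + - 1# * (N * b * δ n k)) + (N * b * diag (suc n) * d + - 1# * (N * b * diag (suc n) * d)) +
    N * b * offdiag (suc (suc n)) * e
      ≈⟨ trans (+-congʳ (trans (+-cong (cancel _) (cancel _)) (+-identityˡ _))) (+-identityˡ _) ⟩
    norm (suc (suc n)) * δ (suc (suc n)) k ∎
    where
    N = norm n
    b = offdiag (suc n)
    d = δ (suc n) k
    e = δ (suc (suc n)) k

  norm-formula : ∀ n → norm n ≈ y ^ n * (n !q) ^ 2
  norm-formula zero    = solve 0 (con 1 := con 1 :* (con 1 :* (con 1 :* con 1))) refl
  norm-formula (suc n) = trans (*-congʳ (norm-formula n))
    (solve 4 (λ p f y b → p :* (f :* (f :* con 1)) :* (y :* (b :* b)) := y :* p :* (f :* b :* (f :* b :* con 1)))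
      refl (y ^ n) (n !q) y ⟦ suc n ⟧)

  -- k sources are pending and m positions are still to be scanned.
  G : ℕ → Seq
  G m k = W k k (k ℕ.+ m)

  G-0 : G 0 ≐ δ 0
  G-0 zero    = trans (W-0-0 0) (trans (+-identityʳ _) (*-identityʳ _))
  G-0 (suc k) = trans (reflexive (≡.cong (W (suc k) (suc k)) (ℕ.+-identityʳ (suc k)))) (W-closed k)

  -- Both halves of a scan step combined. Closing only an upper arc or only a lower arc gives the
  -- two parts of `diag`, closing one of each gives `offdiag`, and closing none leaves one more of
  -- each open.
  G-suc : ∀ m → G (suc m) ≐ J (G m)
  G-suc m zero    = begin
    W 0 0 (suc m)                                          ≈⟨ W-position m 0 z≤n ⟩
    W 1 0 (suc m) + ⟦ 0 ⟧ * W 0 0 m                        ≈⟨ +-cong (W-value m 0 z≤n) (*-congʳ ⟦0⟧) ⟩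
    W 1 1 (suc m) + y * ⟦ 1 ⟧ * W 0 0 m + 0# * W 0 0 m
      ≈⟨ +-assoc _ _ _ ⟩
    W 1 1 (suc m) + (y * ⟦ 1 ⟧ * W 0 0 m + 0# * W 0 0 m)
      ≈⟨ +-congˡ (trans (sym (distribʳ _ _ _)) (*-congʳ (+-congˡ (sym ⟦0⟧)))) ⟩
    W 1 1 (suc m) + diag 0 * W 0 0 m                       ∎
  G-suc m (suc k) = begin
    W (suc k) (suc k) (suc k ℕ.+ suc m)
      ≈⟨ reflexive (≡.cong (W (suc k) (suc k)) (ℕ.+-suc (suc k) m)) ⟩
    W (suc k) (suc k) (suc N)
      ≈⟨ W-position N (suc k) 1+k≤N ⟩
    W (suc (suc k)) (suc k) (suc N) + B * W (suc k) k N
      -- Closing a lower arc leaves `W (suc k) k N`, again a state between two halves but one size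
      -- smaller, so `W-value` applies a second time and yields the square of `B`.
      ≈⟨ +-cong (W-value N (suc k) 1+k≤N) (*-congˡ (W-value (k ℕ.+ m) k (ℕ.m≤m+n k m))) ⟩
    W (suc (suc k)) (suc (suc k)) (suc N) + y * A * W (suc k) (suc k) N +
    B * (W (suc k) (suc k) N + y * B * W k k (k ℕ.+ m))
      ≈⟨ solve 6 (λ u y a w b z → u :+ y :* a :* w :+ b :* (w :+ y :* b :* z) :=
           u :+ ((y :* a :+ b) :* w :+ (y :* (b :* b)) :* z))
         refl _ y A (W (suc k) (suc k) N) B (W k k (k ℕ.+ m)) ⟩
    J (G m) (suc k) ∎
    where
    N = suc k ℕ.+ m
    A = ⟦ suc (suc k) ⟧
    B = ⟦ suc k ⟧
    1+k≤N : suc k ℕ.≤ N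
    1+k≤N = ℕ.m≤m+n (suc k) m

  G-iter : ∀ m → G m ≐ iter J m (δ 0)
  G-iter zero    k = G-0 k
  G-iter (suc m) k = trans (G-suc m k) (trans (J.resp (G-iter m) k)
    (reflexive (≡.cong (λ v → v k) (≡.sym (iter-suc J m (δ 0))))))

  𝓛-act : ∀ p → 𝓛 p ≈ act J p (δ 0) 0
  𝓛-act p = functional-congˡ p (λ m → trans (sym (W-0-0 m)) (G-iter m 0))

  orthogonality : ∀ n₁ n₂ → 𝓛 (L n₁ *ₚ L n₂) ≈ y ^ n₁ * (n₁ !q) ^ 2 * δ n₁ n₂
  orthogonality n₁ n₂ = begin
    𝓛 (L n₁ *ₚ L n₂)                      ≈⟨ 𝓛-act (L n₁ *ₚ L n₂) ⟩
    act J (L n₁ *ₚ L n₂) (δ 0) 0           ≈⟨ act-* J-linear (L n₁) (L n₂) (δ 0) 0 ⟩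
    act J (L n₁) (act J (L n₂) (δ 0)) 0    ≈⟨ act-L-at-0 n₁ _ ⟩
    act J (L n₂) (δ 0) n₁                  ≈⟨ act-L-δ-0 n₂ n₁ ⟩
    norm n₂ * δ n₂ n₁                      ≈⟨ *-congˡ (δ-sym n₂ n₁) ⟩
    norm n₂ * δ n₁ n₂                      ≈⟨ δ-*-cong norm n₁ n₂ ⟩
    norm n₁ * δ n₁ n₂                      ≈⟨ *-congʳ (norm-formula n₁) ⟩
    y ^ n₁ * (n₁ !q) ^ 2 * δ n₁ n₂         ∎
    where
    δ-sym : ∀ m n → δ m n ≈ δ n m
    δ-sym zero    zero    = refl
    δ-sym zero    (suc n) = refl
    δ-sym (suc m) zero    = refl
    δ-sym (suc m) (suc n) = δ-sym m n

theorem2 : ∀ {c ℓ} (R : CommutativeRing c ℓ) (P : Parameters R) →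
  let open CommutativeRing R
      open Exp semiring using (_^_)
      open Polynomial R
      open Parameters P
      open QLaguerre P
  in ∀ (n₁ n₂ : ℕ) →
     𝓛 (L n₁ *ₚ L n₂) ≈ y ^ n₁ * (n₁ !q) ^ 2 * δ n₁ n₂
theorem2 R P = Orthogonality.orthogonality P
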